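{- Let $f_t=\prod_{n\ge 1}(1-q^{nt})$ and define integers $p_j(n)$ by $f_1^{j}=\sum_{n\ge0}p_j(n)q^n$. Let $A_k(\alpha)$ and $B_k(\alpha)$ ($1\le k\le 3$, $\alpha\ge 0$) be the integer sequences which, for each fixed $k$, both satisfy the recurrence $$s(\alpha+4)=f(k)\,s(\alpha+2)+g(k)\,s(\alpha)\qquad(\alpha\ge 0),$$ where $f(1)=-2^3,\ g(1)=0$; $f(2)=2^3\cdot 13,\ g(2)=-2^{14}$; $f(3)=-2^6\cdot5\cdot 11,\ g(3)=-2^{22}$, with the initial values - $k=1$: $A_1(0)=1,\ A_1(1)=-8,\ A_1(2)=-8,\ A_1(3)=64$, and $B_1(\alpha)=0$ for all $\alpha$; - $k=2$: $A_2(0)=1,\ A_2(1)=128,\ A_2(2)=104,\ A_2(3)=-3072$; $B_2(0)=0,\ B_2(1)=1,\ B_2(2)=-2048,\ B_2(3)=104$; - $k=3$: $A_3(0)=1,\ A_3(1)=-2048,\ A_3(2)=-1472,\ A_3(3)=3014656$; $B_3(0)=0,\ B_3(1)=-24,\ B_3(2)=49152,\ B_3(3)=84480$. Then for every $\alpha\ge 0$ and $1\le k\le 3$, as formal Laurent series in $q$, $$\sum_{n=0}^\infty p_{8k}\Big(2^{2\alpha}n+\frac{k(2^{2\alpha}-1)}{3}\Big)q^n=A_k(2\alpha)f_1^{8k}+B_k(2\alpha)\,q^{\lfloor k/2\rfloor}f_1^{8k-24}f_2^{24}$$ and $$\sum_{n=-\lfloor k/2\rfloor}^\infty p_{8k}\Big(2^{2\alpha+1}n+\frac{k(2^{2\alpha+2}-1)}{3}\Big)q^n=A_k(2\alpha+1)f_2^{8k}+B_k(2\alpha+1)\,q^{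 -\lfloor k/2\rfloor}f_1^{24}f_2^{8k-24}.$$
   Context: All identities are between formal Laurent series in $q$ with integer coefficients; negative powers of $f_t$ are the inverses of $f_t$ in the ring of formal power series. -}

module Defs where

open import Algebra.Bundles using (CommutativeRing)
open import Data.Bool using (if_then_else_)
open import Data.Fin using (Fin; zero; suc; toℕ)
open import Data.Fin.Properties using (toℕ<n)
open import Data.Integer using (ℤ; +_; -[1+_]; -_; _+_; _*_; _-_; _⊓_; 0ℤ; 1ℤ)
open import Data.Integer.Properties
  using (+-*-commutativeRing; *-identityˡ; +-identityʳ; +-inverseˡ)
open import Data.Nat as ℕ using (ℕ; zero; suc; _∸_; _≤_; _<_; _≟_; z≤n)
import Data.Nat.Properties as ℕₚ
open import Data.Vec using (Vec; []; _∷_; head; lookup)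
open import Relation.Binary.PropositionalEquality
  using (_≡_; _≢_; refl; sym; trans; cong; cong₂; module ≡-Reasoning)
open import Relation.Nullary using (does; yes; no)
open import Relation.Nullary.Decidable using (dec-false)

open import Algebra.Properties.Semiring.Sum (CommutativeRing.semiring +-*-commutativeRing)
  using (sum; sum-cong-≗; sum-replicate-zero)

------------------------------------------------------------------------
-- Formal power series over ℤ: a n is the coefficient of q^n.

PowerSeries : Set
PowerSeries = ℕ → ℤ

X^ : ℕ → PowerSeries
X^ d m = if does (d ≟ m) then 1ℤ else 0ℤ

one : PowerSeries
one = X^ 0

infixl 7 _⊛_
infixl 6 _⊝_

_⊝_ : PowerSeries → PowerSeries → PowerSeries
(a ⊝ b) n = a n - b n

_⊛_ : PowerSeries → PowerSeries → PowerSeries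
(a ⊛ b) n = sum {suc n} (λ i → a (toℕ i) * b (n ∸ toℕ i))

-- For a 0 ≡ 1 the inverse b of a is determined by b₀ = 1 and
-- bₙ₊₁ = - (a₁ bₙ + … + aₙ₊₁ b₀); invCoeffs a n is the table bₙ, …, b₀.
-- See inv-inverseʳ.  When a 0 ≢ 1 the value of inv a is meaningless.
invCoeffs : PowerSeries → (n : ℕ) → Vec ℤ (suc n)
invCoeffs a zero    = 1ℤ ∷ []
invCoeffs a (suc n) =
  - sum (λ i → a (suc (toℕ i)) * lookup (invCoeffs a n) i) ∷ invCoeffs a n

inv : PowerSeries → PowerSeries
inv a n = head (invCoeffs a n)

pow : PowerSeries → ℕ → PowerSeries
pow a zero    = one
pow a (suc n) = a ⊛ pow a n

infixr 8 _^_

_^_ : PowerSeries → ℤ → PowerSeries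
a ^ (+ n)    = pow a n
a ^ -[1+ n ] = pow (inv a) (suc n)

partialProduct : ℕ → ℕ → PowerSeries
partialProduct t zero    = one
partialProduct t (suc N) = (one ⊝ X^ (suc N ℕ.* t)) ⊛ partialProduct t N

-- f t = ∏_{n ≥ 1} (1 - q^{nt}) for t ≥ 1.  The factors with n > m do not
-- affect the coefficient of q^m, so it can be read off from the product over
-- n ≤ m; see f-limit.
f : ℕ → PowerSeries
f t m = partialProduct t m m

------------------------------------------------------------------------
-- Formal Laurent series.  laurent v a stands for Σ_{i ≥ 0} a i · q^{v+i};
-- the representation is not unique, so equality is coefficientwise (_≈_).

record Laurent : Set where
  constructor laurent
  field
    low  : ℤ
    tail : PowerSeries

open Laurent

extend : PowerSeries → ℤ → ℤ
extend a (+ n)    = a n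
extend a -[1+ _ ] = 0ℤ

coeff : Laurent → ℤ → ℤ
coeff x m = extend (tail x) (m - low x)

infix 4 _≈_

_≈_ : Laurent → Laurent → Set
x ≈ y = ∀ m → coeff x m ≡ coeff y m

⟦_⟧ : PowerSeries → Laurent
⟦ a ⟧ = laurent 0ℤ a

q^_ : ℤ → Laurent
q^ v = laurent v one

-- Σ_{n ≥ v} c n · q^n
∑≥ : ℤ → (ℤ → ℤ) → Laurent
∑≥ v c = laurent v (λ i → c (v + + i))

infixl 6 _⊞_
infixl 7 _⊠_
infixr 7 _•_
infix  9 q^_

_⊞_ : Laurent → Laurent → Laurent
x ⊞ y = ∑≥ (low x ⊓ low y) (λ m → coeff x m + coeff y m)

_⊠_ : Laurent → Laurent → Laurent
x ⊠ y = laurent (low x + low y) (tail x ⊛ tail y)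

_•_ : ℤ → Laurent → Laurent
c • x = laurent (low x) (λ i → c * tail x i)

------------------------------------------------------------------------
-- p j n is the coefficient of q^n in f₁^j (so 0 for n < 0).

p : ℤ → ℤ → ℤ
p j n = coeff ⟦ f 1 ^ j ⟧ n

------------------------------------------------------------------------
-- The sequences A_k and B_k.  Only k = 1, 2, 3 are meaningful; the remaining
-- values of k are filled with zeros.

recF recG : ℕ → ℤ
recF 1 = - + (2 ℕ.^ 3)
recF 2 = + (2 ℕ.^ 3 ℕ.* 13)
recF 3 = - + (2 ℕ.^ 6 ℕ.* 5 ℕ.* 11)
recF _ = 0ℤ
recG 1 = 0ℤ
recG 2 = - + (2 ℕ.^ 14)
recG 3 = - + (2 ℕ.^ 22)
recG _ = 0ℤ

recurrent : (F G s₀ s₁ s₂ s₃ : ℤ) → ℕ → ℤ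
recurrent F G s₀ s₁ s₂ s₃ = s
  where
  s : ℕ → ℤ
  s 0 = s₀
  s 1 = s₁
  s 2 = s₂
  s 3 = s₃
  s (suc (suc (suc (suc α)))) = F * s (suc (suc α)) + G * s α

A B : ℕ → ℕ → ℤ
A 1 = recurrent (recF 1) (recG 1) (+ 1) (- + 8) (- + 8) (+ 64)
A 2 = recurrent (recF 2) (recG 2) (+ 1) (+ 128) (+ 104) (- + 3072)
A 3 = recurrent (recF 3) (recG 3) (+ 1) (- + 2048) (- + 1472) (+ 3014656)
A _ = λ _ → 0ℤ
B 1 = λ _ → 0ℤ
B 2 = recurrent (recF 2) (recG 2) (+ 0) (+ 1) (- + 2048) (+ 104)
B 3 = recurrent (recF 3) (recG 3) (+ 0) (- + 24) (+ 49152) (+ 84480)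
B _ = λ _ → 0ℤ

------------------------------------------------------------------------
-- Justification of inv and f.

sum-zero : ∀ {n} (g : Fin n → ℤ) → (∀ i → g i ≡ 0ℤ) → sum g ≡ 0ℤ
sum-zero {n} g g≡0 = trans (sum-cong-≗ g≡0) (sum-replicate-zero n)

lookup-invCoeffs : ∀ a n (i : Fin (suc n)) → lookup (invCoeffs a n) i ≡ inv a (n ∸ toℕ i)
lookup-invCoeffs a zero    zero    = refl
lookup-invCoeffs a (suc n) zero    = refl
lookup-invCoeffs a (suc n) (suc i) = lookup-invCoeffs a n i

inv-inverseʳ : ∀ a → a 0 ≡ 1ℤ → ∀ n → (a ⊛ inv a) n ≡ one n
inv-inverseʳ a a₀≡1 zero    = cong (λ z → z * 1ℤ + 0ℤ) a₀≡1
inv-inverseʳ a a₀≡1 (suc n) = begin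
  a 0 * - S + sum {suc n} (λ i → a (suc (toℕ i)) * inv a (n ∸ toℕ i))
    ≡⟨ cong₂ _+_ (cong (_* - S) a₀≡1)
        (sum-cong-≗ {suc n} (λ i → cong (a (suc (toℕ i)) *_) (sym (lookup-invCoeffs a n i)))) ⟩
  1ℤ * - S + S  ≡⟨ cong (_+ S) (*-identityˡ (- S)) ⟩
  - S + S       ≡⟨ +-inverseˡ S ⟩
  0ℤ            ∎
  where
  open ≡-Reasoning
  S : ℤ
  S = sum (λ i → a (suc (toℕ i)) * lookup (invCoeffs a n) i)

f-constant : ∀ t → f t 0 ≡ 1ℤ
f-constant t = refl

X^-off : ∀ {d m} → d ≢ m → X^ d m ≡ 0ℤ
X^-off {d} {m} d≢m = cong (λ b → if b then 1ℤ else 0ℤ) (dec-false (d ≟ m) d≢m)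

[1-X^]⊛-low : ∀ d a m → m < d → ((one ⊝ X^ d) ⊛ a) m ≡ a m
[1-X^]⊛-low (suc d) a m m<d = begin
  1ℤ * a m + sum {m} (λ i → (one ⊝ X^ (suc d)) (suc (toℕ i)) * a (m ∸ suc (toℕ i)))
    ≡⟨ cong₂ _+_ (*-identityˡ (a m)) (sum-zero {m} _ vanish) ⟩
  a m + 0ℤ  ≡⟨ +-identityʳ (a m) ⟩
  a m       ∎
  where
  open ≡-Reasoning
  vanish : ∀ (i : Fin m) → (one ⊝ X^ (suc d)) (suc (toℕ i)) * a (m ∸ suc (toℕ i)) ≡ 0ℤ
  vanish i = cong (λ z → (0ℤ - z) * a (m ∸ suc (toℕ i)))
    (X^-off (ℕₚ.>⇒≢ (ℕₚ.≤-<-trans (toℕ<n i) m<d)))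

f-limit : ∀ t .{{_ : ℕ.NonZero t}} N m → m ≤ N → partialProduct t N m ≡ f t m
f-limit t zero    zero z≤n = refl
f-limit t (suc N) m m≤1+N with m ≟ suc N
... | yes refl  = refl
... | no m≢1+N =
  trans ([1-X^]⊛-low (suc N ℕ.* t) (partialProduct t N) m
          (ℕₚ.<-≤-trans m<1+N (ℕₚ.m≤m*n (suc N) t)))
        (f-limit t N m (ℕₚ.≤-pred m<1+N))
  where
  m<1+N : m < suc N
  m<1+N = ℕₚ.≤∧≢⇒< m≤1+N m≢1+N

-- Passing from one identity to the next extracts the even or the odd coefficients,
-- so the theorem reduces to a handful of 2-dissections, and these follow from two facts:
-- the norm f₁(q) f₁(-q) = f₂³ / f₄ and the odd part od(f₁⁸) = -8 f₂⁸.  The latter is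
-- Jacobi's identity φ(q)⁴ - φ(-q)⁴ = 16 q ψ(q²)⁴.  Its only input from theta series is
-- Gauss's formula f₁² / f₂ = 1 + 2 ∑ (-1)ⁿ q^{n²} = φ(-q), whose even part is φ(q⁴): this gives
-- φ(q)² + φ(-q)² = 2 φ(q²)², since the difference D of both sides satisfies D(q) = -2 D(q²);
-- and then od(f₁⁸) and -8 f₂⁸ both solve an equation u(q)² w(q) = c(q) u(q²), which has at most
-- one solution with a given non-zero constant term.
module Submission where

open import Defs
open import Algebra.Bundles using (CommutativeRing)
open import Algebra.Solver.Ring.AlmostCommutativeRing using (fromCommutativeRing; _-Raw-AlmostCommutative⟶_)
import Algebra.Solver.Ring
open import Algebra.Structures using (IsCommutativeRing)
open import Data.Integer as ℤ using (ℤ; +_; -[1+_]; -_; _+_; _*_; _-_; 0ℤ; 1ℤ)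
import Data.Integer.Properties as ℤₚ
open import Data.Integer.Tactic.RingSolver using (solve-∀)
open import Data.Maybe using (Maybe; just; nothing)
open import Data.Nat as ℕ using (ℕ; zero; suc; _∸_; _≤_; _<_; z≤n; s≤s; ⌊_/2⌋)
open import Data.Nat.DivMod using (_/_; m*n/n≡m)
import Data.Nat.Properties as ℕₚ
open import Data.Nat.Tactic.RingSolver using () renaming (solve-∀ to solve-∀ₙ)
open import Data.Product using (_×_; _,_)
open import Data.Sum using (inj₁; inj₂)
open import Level using (0ℓ)
open import Relation.Binary.Bundles using (Setoid)
import Relation.Binary.Reasoning.Setoid
open import Relation.Binary.PropositionalEquality
  using (_≡_; _≢_; refl; sym; trans; cong; cong₂; subst; subst₂; module ≡-Reasoning)
open import Relation.Nullary using (yes; no; contradiction)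

-- For each k the series of the first identity lie in the span of two fixed series, those of the
-- second identity in the span of two others, and the two parity extractions act on coordinate
-- vectors by constant 2 by 2 matrices. Their product sends (A_k(2α), B_k(2α)) to (A_k(2α+2),
-- B_k(2α+2)), and f(k) and -g(k) are its trace and determinant: the recurrence is Cayley-Hamilton.
-- For k = 2 the matrices are (128 8; 1 0) and (1 -24; 0 -2048), whose product has trace 104 and
-- determinant 2^14. For k = 1 the second coordinate is zero padding.
--
-- The even part e of f₁⁸ has no counterpart of the closed form of the odd part. In the dissections
-- of f₁¹⁶ and f₁²⁴ it enters only through e², which the norm eliminates: e² - 64 q f₂¹⁶ = f₁²⁴ /
-- f₂⁸. For f₁⁻⁸ the same norm is the determinant of a linear system.
--
-- Equations that relate a series to its image under q ↦ q² replace the triple product here: the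
-- image at a given coefficient involves only earlier coefficients of the series, so such an
-- equation can be solved recursively.

-- The commutative ring of integer power series

infix  4 _≋_
infixl 6 _⊕_

-- A record instead of _≗_, so that both series can be inferred from a proof.
record _≋_ (a b : PowerSeries) : Set where
  constructor mk≋
  field at : ∀ n → a n ≡ b n

open _≋_

≋-refl : ∀ {a} → a ≋ a
≋-refl .at n = refl

≋-sym : ∀ {a b} → a ≋ b → b ≋ a
≋-sym a≋b .at n = sym (at a≋b n)

≋-trans : ∀ {a b c} → a ≋ b → b ≋ c → a ≋ c
≋-trans a≋b b≋c .at n = trans (at a≋b n) (at b≋c n)

≋-setoid : Setoid 0ℓ 0ℓ
≋-setoid = record
  { _≈_           = _≋_
  ; isEquivalence = record { refl = ≋-refl ; sym = ≋-sym ; trans = ≋-trans }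
  }

module ≋-Reasoning = Relation.Binary.Reasoning.Setoid ≋-setoid

_⊕_ : PowerSeries → PowerSeries → PowerSeries
(a ⊕ b) n = a n + b n

neg : PowerSeries → PowerSeries
neg a n = - a n

const : ℤ → PowerSeries
const c zero    = c
const c (suc _) = 0ℤ

tl : PowerSeries → PowerSeries
tl a n = a (suc n)

+-congˡ : ∀ x {y z} → y ≡ z → x + y ≡ x + z
+-congˡ x = cong (λ y → x + y)

⊕-cong : ∀ {a a′ b b′} → a ≋ a′ → b ≋ b′ → a ⊕ b ≋ a′ ⊕ b′
⊕-cong a≋ b≋ .at n = cong₂ _+_ (at a≋ n) (at b≋ n)

neg-cong : ∀ {a a′} → a ≋ a′ → neg a ≋ neg a′
neg-cong a≋ .at n = cong -_ (at a≋ n)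

-- Products are causal. This is what lets identities between finite products pass to the limit and
-- what makes inductions on the coefficient index possible.
⊛-local : ∀ {a a′ b b′} n → (∀ i → i ≤ n → a i ≡ a′ i) → (∀ i → i ≤ n → b i ≡ b′ i) →
          (a ⊛ b) n ≡ (a′ ⊛ b′) n
⊛-local zero a≡ b≡ = cong (_+ 0ℤ) (cong₂ _*_ (a≡ 0 z≤n) (b≡ 0 z≤n))
⊛-local (suc n) a≡ b≡ = cong₂ _+_
  (cong₂ _*_ (a≡ 0 z≤n) (b≡ (suc n) ℕₚ.≤-refl))
  (⊛-local n (λ i i≤n → a≡ (suc i) (s≤s i≤n)) (λ i i≤n → b≡ i (ℕₚ.m≤n⇒m≤1+n i≤n)))

⊛-cong : ∀ {a a′ b b′} → a ≋ a′ → b ≋ b′ → a ⊛ b ≋ a′ ⊛ b′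
⊛-cong a≋ b≋ .at n = ⊛-local n (λ i _ → at a≋ i) (λ i _ → at b≋ i)

⊛-distribʳ : ∀ c a b → (a ⊕ b) ⊛ c ≋ a ⊛ c ⊕ b ⊛ c
⊛-distribʳ c a b .at = go a b
  where
  go : ∀ a b n → ((a ⊕ b) ⊛ c) n ≡ (a ⊛ c) n + (b ⊛ c) n
  go a b zero = lemma (a 0) (b 0) (c 0)
    where
    lemma : ∀ x y z → (x + y) * z + 0ℤ ≡ (x * z + 0ℤ) + (y * z + 0ℤ)
    lemma = solve-∀
  go a b (suc n) = trans (+-congˡ ((a 0 + b 0) * c (suc n)) (go (tl a) (tl b) n))
                         (lemma (a 0) (b 0) (c (suc n)) ((tl a ⊛ c) n) ((tl b ⊛ c) n))
    where
    lemma : ∀ x y z u v → (x + y) * z + (u + v) ≡ (x * z + u) + (y * z + v)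
    lemma = solve-∀

zero-⊛ : ∀ a n → ((λ _ → 0ℤ) ⊛ a) n ≡ 0ℤ
zero-⊛ a zero    = refl
zero-⊛ a (suc n) = trans (ℤₚ.+-identityˡ _) (zero-⊛ a n)

const-⊛ : ∀ c a n → (const c ⊛ a) n ≡ c * a n
const-⊛ c a zero    = ℤₚ.+-identityʳ _
const-⊛ c a (suc n) = trans (+-congˡ (c * a (suc n)) (zero-⊛ a n)) (ℤₚ.+-identityʳ _)

-- The defining sum peels off the constant term of the left factor; this mirror image, peeling the
-- right one, turns commutativity into an induction.
⊛-unfoldʳ : ∀ a b n → (a ⊛ b) (suc n) ≡ a (suc n) * b 0 + (a ⊛ tl b) n
⊛-unfoldʳ a b zero = lemma (a 0) (a 1) (b 0) (b 1)
  where
  lemma : ∀ x y z u → x * u + (y * z + 0ℤ) ≡ y * z + (x * u + 0ℤ)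
  lemma = solve-∀
⊛-unfoldʳ a b (suc n) = trans (+-congˡ (a 0 * b (suc (suc n))) (⊛-unfoldʳ (tl a) b n))
                                (lemma (a 0 * b (suc (suc n))) (a (suc (suc n)) * b 0) ((tl a ⊛ tl b) n))
  where
  lemma : ∀ x y z → x + (y + z) ≡ y + (x + z)
  lemma = solve-∀

⊛-comm : ∀ a b → a ⊛ b ≋ b ⊛ a
⊛-comm a b .at = go a
  where
  go : ∀ a n → (a ⊛ b) n ≡ (b ⊛ a) n
  go a zero    = cong (_+ 0ℤ) (ℤₚ.*-comm (a 0) (b 0))
  go a (suc n) = trans (cong₂ _+_ (ℤₚ.*-comm (a 0) _) (go (tl a) n)) (sym (⊛-unfoldʳ b a n))

⊛-scaleˡ : ∀ c a b n → ((λ i → c * a i) ⊛ b) n ≡ c * (a ⊛ b) n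
⊛-scaleˡ c a b zero = lemma c (a 0) (b 0)
  where
  lemma : ∀ x y z → (x * y) * z + 0ℤ ≡ x * (y * z + 0ℤ)
  lemma = solve-∀
⊛-scaleˡ c a b (suc n) =
  trans (+-congˡ ((c * a 0) * b (suc n)) (⊛-scaleˡ c (tl a) b n))
        (lemma c (a 0) (b (suc n)) ((tl a ⊛ b) n))
  where
  lemma : ∀ x y z u → (x * y) * z + x * u ≡ x * (y * z + u)
  lemma = solve-∀

⊛-assoc : ∀ a b c → (a ⊛ b) ⊛ c ≋ a ⊛ (b ⊛ c)
⊛-assoc a b c .at = go a
  where
  go : ∀ a n → ((a ⊛ b) ⊛ c) n ≡ (a ⊛ (b ⊛ c)) n
  go a zero = lemma (a 0) (b 0) (c 0)
    where
    lemma : ∀ x y z → (x * y + 0ℤ) * z + 0ℤ ≡ x * (y * z + 0ℤ) + 0ℤ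
    lemma = solve-∀
  go a (suc n) = begin
    (a 0 * b 0 + 0ℤ) * c (suc n) + (((λ i → a 0 * tl b i) ⊕ tl a ⊛ b) ⊛ c) n
      ≡⟨ +-congˡ ((a 0 * b 0 + 0ℤ) * c (suc n)) (at (⊛-distribʳ c (λ i → a 0 * tl b i) (tl a ⊛ b)) n) ⟩
    (a 0 * b 0 + 0ℤ) * c (suc n) + (((λ i → a 0 * tl b i) ⊛ c) n + ((tl a ⊛ b) ⊛ c) n)
      ≡⟨ +-congˡ ((a 0 * b 0 + 0ℤ) * c (suc n)) (cong₂ _+_ (⊛-scaleˡ (a 0) (tl b) c n) (go (tl a) n)) ⟩
    (a 0 * b 0 + 0ℤ) * c (suc n) + (a 0 * (tl b ⊛ c) n + (tl a ⊛ (b ⊛ c)) n)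
      ≡⟨ lemma (a 0) (b 0) (c (suc n)) _ _ ⟩
    a 0 * (b 0 * c (suc n) + (tl b ⊛ c) n) + (tl a ⊛ (b ⊛ c)) n ∎
    where
    open ≡-Reasoning
    lemma : ∀ x y z u v → (x * y + 0ℤ) * z + (x * u + v) ≡ x * (y * z + u) + v
    lemma = solve-∀

one≋const : one ≋ const 1ℤ
one≋const .at zero    = refl
one≋const .at (suc n) = refl

⊛-identityˡ : ∀ a → one ⊛ a ≋ a
⊛-identityˡ a .at n = trans (at (⊛-cong {b = a} one≋const ≋-refl) n)
                            (trans (const-⊛ 1ℤ a n) (ℤₚ.*-identityˡ (a n)))

infixl 7 _·_

-- Convolution with its definition hidden: otherwise the conversion checker
-- compares products coefficient by coefficient, in exponential time.
opaque
  _·_ : PowerSeries → PowerSeries → PowerSeries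
  _·_ = _⊛_

  ·≋⊛ : ∀ a b → a · b ≋ a ⊛ b
  ·≋⊛ a b = ≋-refl

  ·-local : ∀ {a a′ b b′} n → (∀ i → i ≤ n → a i ≡ a′ i) → (∀ i → i ≤ n → b i ≡ b′ i) →
            (a · b) n ≡ (a′ · b′) n
  ·-local = ⊛-local

  const-· : ∀ c a n → (const c · a) n ≡ c * a n
  const-· = const-⊛

  isCommutativeRing : IsCommutativeRing _≋_ _⊕_ _·_ neg (const 0ℤ) one
  isCommutativeRing = record
    { isRing = record
      { +-isAbelianGroup = record
        { isGroup = record
          { isMonoid = record
            { isSemigroup = record
              { isMagma = record { isEquivalence = Setoid.isEquivalence ≋-setoid ; ∙-cong = ⊕-cong }
              ; assoc = λ a b c → mk≋ λ n → ℤₚ.+-assoc (a n) (b n) (c n)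
              }
            ; identity = (λ a → mk≋ λ { zero → ℤₚ.+-identityˡ _ ; (suc n) → ℤₚ.+-identityˡ _ })
                       , (λ a → mk≋ λ { zero → ℤₚ.+-identityʳ _ ; (suc n) → ℤₚ.+-identityʳ _ })
            }
          ; inverse = (λ a → mk≋ λ { zero → ℤₚ.+-inverseˡ (a 0) ; (suc n) → ℤₚ.+-inverseˡ (a (suc n)) })
                    , (λ a → mk≋ λ { zero → ℤₚ.+-inverseʳ (a 0) ; (suc n) → ℤₚ.+-inverseʳ (a (suc n)) })
          ; ⁻¹-cong = neg-cong
          }
        ; comm = λ a b → mk≋ λ n → ℤₚ.+-comm (a n) (b n)
        }
      ; *-cong = ⊛-cong
      ; *-assoc = ⊛-assoc
      ; *-identity = ⊛-identityˡ , λ a → ≋-trans (⊛-comm a one) (⊛-identityˡ a)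
      ; distrib = (λ a b c → ≋-trans (⊛-comm a (b ⊕ c))
                    (≋-trans (⊛-distribʳ a b c) (⊕-cong (⊛-comm b a) (⊛-comm c a))))
                , ⊛-distribʳ
      }
    ; *-comm = ⊛-comm
    }

seriesRing : CommutativeRing 0ℓ 0ℓ
seriesRing = record { isCommutativeRing = isCommutativeRing }

open CommutativeRing seriesRing using () renaming
  ( *-cong to ·-cong; *-congˡ to ·-congˡ; *-congʳ to ·-congʳ; *-assoc to ·-assoc; *-comm to ·-comm
  ; *-identityˡ to ·-identityˡ; *-identityʳ to ·-identityʳ)

-- Gives the ring solver integer coefficients: equality of series is not decidable, equality of
-- integer constants is.
const-homomorphism : CommutativeRing.rawRing ℤₚ.+-*-commutativeRing
                       -Raw-AlmostCommutative⟶ fromCommutativeRing seriesRing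
const-homomorphism = record
  { ⟦_⟧    = const
  ; +-homo = λ c d → mk≋ λ { zero → refl ; (suc n) → refl }
  ; *-homo = λ c d → mk≋ λ { zero    → sym (const-· c (const d) zero)
                           ; (suc n) → sym (trans (const-· c (const d) (suc n)) (ℤₚ.*-zeroʳ c)) }
  ; -‿homo = λ c → mk≋ λ { zero → refl ; (suc n) → refl }
  ; 0-homo = ≋-refl
  ; 1-homo = ≋-sym one≋const
  }

const-≟ : ∀ c d → Maybe (const c ≋ const d)
const-≟ c d with c ℤ.≟ d
... | yes refl = just ≋-refl
... | no _     = nothing

open Algebra.Solver.Ring (CommutativeRing.rawRing ℤₚ.+-*-commutativeRing)
  (fromCommutativeRing seriesRing) const-homomorphism const-≟
  using (Polynomial; solve; con; _:+_; _:*_; _:-_; :-_; _:=_; _:^_)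

-- con 1ℤ denotes const 1ℤ, which is not definitionally one.
:1 : ∀ {n} → Polynomial n
:1 = con 0ℤ :^ 0

-- Multiplication by q and monomials

q : PowerSeries
q = X^ 1

opaque
  unfolding _·_

  q·-zero : ∀ a → (q · a) 0 ≡ 0ℤ
  q·-zero a = refl

  q·-suc : ∀ a n → (q · a) (suc n) ≡ a n
  q·-suc a n = trans (ℤₚ.+-identityˡ _) (at (·-identityˡ a) n)

X^-suc : ∀ d → X^ (suc d) ≋ q · X^ d
X^-suc d .at zero    = sym (q·-zero (X^ d))
X^-suc d .at (suc n) = sym (q·-suc (X^ d) n)

X^-+ : ∀ d e → X^ (d ℕ.+ e) ≋ X^ d · X^ e
X^-+ zero    e = ≋-sym (·-identityˡ (X^ e))
X^-+ (suc d) e = begin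
  X^ (suc (d ℕ.+ e))    ≈⟨ X^-suc (d ℕ.+ e) ⟩
  q · X^ (d ℕ.+ e)      ≈⟨ ·-congˡ (X^-+ d e) ⟩
  q · (X^ d · X^ e)     ≈⟨ ·-assoc q (X^ d) (X^ e) ⟨
  (q · X^ d) · X^ e     ≈⟨ ·-congʳ (X^-suc d) ⟨
  X^ (suc d) · X^ e     ∎
  where open ≋-Reasoning

-- Even and odd parts

double : ℕ → ℕ
double zero    = zero
double (suc n) = suc (suc (double n))

ev od : PowerSeries → PowerSeries
ev a n = a (double n)
od a n = a (suc (double n))

ev-cong : ∀ {a b} → a ≋ b → ev a ≋ ev b
ev-cong a≋b .at n = at a≋b (double n)

od-cong : ∀ {a b} → a ≋ b → od a ≋ od b
od-cong a≋b .at n = at a≋b (suc (double n))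

-- Passing to tails swaps the halves: `ev (tl a)` is `od a` and `od (tl a)` is `tl (ev a)`, so the
-- induction alternates between them.
ev-od-injective : ∀ {a b} → ev a ≋ ev b → od a ≋ od b → a ≋ b
ev-od-injective {a} {b} ev≋ od≋ .at n = go n a b ev≋ od≋
  where
  go : ∀ n a b → ev a ≋ ev b → od a ≋ od b → a n ≡ b n
  go zero    a b ev≋ od≋ = at ev≋ 0
  go (suc n) a b ev≋ od≋ = go n (tl a) (tl b) od≋ (mk≋ λ i → at ev≋ (suc i))

opaque
  unfolding _·_

  ·-unfoldˡ : ∀ a b n → (a · b) n ≡ a 0 * b n + (q · (tl a · b)) n
  ·-unfoldˡ a b zero    = refl
  ·-unfoldˡ a b (suc n) = +-congˡ (a 0 * b (suc n)) (sym (q·-suc (tl a · b) n))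

  mutual
    -- Peeling off `a 0` leaves `tl a`, whose halves are those of `a` swapped and one of them
    -- shifted; hence the two halves of the product call each other. The recursion ends because the
    -- even half at `suc n` calls the odd half at `n`.
    ev-·-at : ∀ a b n → ev (a · b) n ≡ (ev a · ev b ⊕ q · (od a · od b)) n
    ev-·-at a b zero    = sym (ℤₚ.+-identityʳ _)
    ev-·-at a b (suc n) = begin
      a 0 * ev b (suc n) + od (tl a · b) n
        ≡⟨ +-congˡ (a 0 * ev b (suc n)) (od-·-at (tl a) b n) ⟩
      a 0 * ev b (suc n) + ((od a · od b) n + (tl (ev a) · ev b) n)
        ≡⟨ lemma (a 0 * ev b (suc n)) ((od a · od b) n) ((tl (ev a) · ev b) n) ⟩
      (a 0 * ev b (suc n) + (tl (ev a) · ev b) n) + (od a · od b) n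
        ≡⟨ +-congˡ ((ev a · ev b) (suc n)) (q·-suc (od a · od b) n) ⟨
      (ev a · ev b) (suc n) + (q · (od a · od b)) (suc n) ∎
      where
      open ≡-Reasoning
      lemma : ∀ x y z → x + (y + z) ≡ (x + z) + y
      lemma = solve-∀

    od-·-at : ∀ a b n → od (a · b) n ≡ (ev a · od b ⊕ od a · ev b) n
    od-·-at a b n = begin
      a 0 * od b n + ev (tl a · b) n
        ≡⟨ +-congˡ (a 0 * od b n) (ev-·-at (tl a) b n) ⟩
      a 0 * od b n + ((od a · ev b) n + (q · (tl (ev a) · od b)) n)
        ≡⟨ lemma (a 0 * od b n) ((od a · ev b) n) ((q · (tl (ev a) · od b)) n) ⟩
      (a 0 * od b n + (q · (tl (ev a) · od b)) n) + (od a · ev b) n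
        ≡⟨ cong (_+ (od a · ev b) n) (·-unfoldˡ (ev a) (od b) n) ⟨
      (ev a · od b) n + (od a · ev b) n ∎
      where
      open ≡-Reasoning
      lemma : ∀ x y z → x + (y + z) ≡ (x + z) + y
      lemma = solve-∀

ev-· : ∀ a b → ev (a · b) ≋ ev a · ev b ⊕ q · (od a · od b)
ev-· a b .at = ev-·-at a b

od-· : ∀ a b → od (a · b) ≋ ev a · od b ⊕ od a · ev b
od-· a b .at = od-·-at a b

ev-const : ∀ c → ev (const c) ≋ const c
ev-const c .at zero    = refl
ev-const c .at (suc n) = refl

od-const : ∀ c → od (const c) ≋ const 0ℤ
od-const c .at zero    = refl
od-const c .at (suc n) = refl

ev-q : ev q ≋ const 0ℤ
ev-q .at zero    = refl
ev-q .at (suc n) = refl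

ev-const· : ∀ c a → ev (const c · a) ≋ const c · ev a
ev-const· c a .at n = trans (const-· c a (double n)) (sym (const-· c (ev a) n))

od-const· : ∀ c a → od (const c · a) ≋ const c · od a
od-const· c a .at n = trans (const-· c a (suc (double n))) (sym (const-· c (od a) n))

ev-q· : ∀ a → ev (q · a) ≋ q · od a
ev-q· a .at zero    = trans (q·-zero a) (sym (q·-zero (od a)))
ev-q· a .at (suc n) = trans (q·-suc a (suc (double n))) (sym (q·-suc (od a) n))

od-q· : ∀ a → od (q · a) ≋ ev a
od-q· a .at n = q·-suc a (double n)

-- The substitutions q ↦ q² and q ↦ -q

-- Inverse of the splitting into `ev` and `od`; swapping the arguments at each step replaces a
-- parity test.
merge : PowerSeries → PowerSeries → PowerSeries
merge e o zero    = e 0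
merge e o (suc n) = merge o (tl e) n

ev-merge : ∀ e o → ev (merge e o) ≋ e
ev-merge e o .at = go e o
  where
  go : ∀ e o n → merge e o (double n) ≡ e n
  go e o zero    = refl
  go e o (suc n) = go (tl e) (tl o) n

od-merge : ∀ e o → od (merge e o) ≋ o
od-merge e o .at n = at (ev-merge o (tl e)) n

merge-local : ∀ {e e′ o o′} n → (∀ i → i ≤ n → e i ≡ e′ i) → (∀ i → i ≤ n → o i ≡ o′ i) →
              merge e o n ≡ merge e′ o′ n
merge-local zero    e≡ o≡ = e≡ 0 z≤n
merge-local (suc n) e≡ o≡ = merge-local n (λ i i≤n → o≡ i (ℕₚ.m≤n⇒m≤1+n i≤n))
                                          (λ i i≤n → e≡ (suc i) (s≤s i≤n))

-- E2 a is a(q²) and σ a is a(-q).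
E2 σ : PowerSeries → PowerSeries
E2 a = merge a (const 0ℤ)
σ a = merge (ev a) (neg (od a))

ev-E2 : ∀ a → ev (E2 a) ≋ a
ev-E2 a = ev-merge a (const 0ℤ)

od-E2 : ∀ a → od (E2 a) ≋ const 0ℤ
od-E2 a = od-merge a (const 0ℤ)

ev-σ : ∀ a → ev (σ a) ≋ ev a
ev-σ a = ev-merge (ev a) (neg (od a))

od-σ : ∀ a → od (σ a) ≋ neg (od a)
od-σ a = od-merge (ev a) (neg (od a))

E2-cong : ∀ {a b} → a ≋ b → E2 a ≋ E2 b
E2-cong a≋b .at n = merge-local n (λ i _ → at a≋b i) (λ _ _ → refl)

σ-cong : ∀ {a b} → a ≋ b → σ a ≋ σ b
σ-cong {a} {b} a≋b .at n =
  merge-local n (λ i _ → at a≋b (double i)) (λ i _ → cong -_ (at a≋b (suc (double i))))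

ev-E2· : ∀ a b → ev (E2 a · b) ≋ a · ev b
ev-E2· a b = begin
  ev (E2 a · b)                                   ≈⟨ ev-· (E2 a) b ⟩
  ev (E2 a) · ev b ⊕ q · (od (E2 a) · od b)
    ≈⟨ ⊕-cong (·-congʳ (ev-E2 a)) (·-congˡ (·-congʳ (od-E2 a))) ⟩
  a · ev b ⊕ q · (const 0ℤ · od b)
    ≈⟨ solve 4 (λ a e q o → a :* e :+ q :* (con 0ℤ :* o) := a :* e) ≋-refl a (ev b) q (od b) ⟩
  a · ev b                                        ∎
  where open ≋-Reasoning

od-E2· : ∀ a b → od (E2 a · b) ≋ a · od b
od-E2· a b = begin
  od (E2 a · b)                                   ≈⟨ od-· (E2 a) b ⟩
  ev (E2 a) · od b ⊕ od (E2 a) · ev b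
    ≈⟨ ⊕-cong (·-congʳ (ev-E2 a)) (·-congʳ (od-E2 a)) ⟩
  a · od b ⊕ const 0ℤ · ev b
    ≈⟨ solve 3 (λ a e o → a :* o :+ con 0ℤ :* e := a :* o) ≋-refl a (ev b) (od b) ⟩
  a · od b                                        ∎
  where open ≋-Reasoning

E2-· : ∀ a b → E2 (a · b) ≋ E2 a · E2 b
E2-· a b = ev-od-injective
  (begin
    ev (E2 (a · b))    ≈⟨ ev-E2 (a · b) ⟩
    a · b              ≈⟨ ·-congˡ (ev-E2 b) ⟨
    a · ev (E2 b)      ≈⟨ ev-E2· a (E2 b) ⟨
    ev (E2 a · E2 b)   ∎)
  (begin
    od (E2 (a · b))    ≈⟨ od-E2 (a · b) ⟩
    const 0ℤ           ≈⟨ solve 1 (λ a → con 0ℤ := a :* con 0ℤ) ≋-refl a ⟩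
    a · const 0ℤ       ≈⟨ ·-congˡ (od-E2 b) ⟨
    a · od (E2 b)      ≈⟨ od-E2· a (E2 b) ⟨
    od (E2 a · E2 b)   ∎)
  where open ≋-Reasoning

E2-⊝ : ∀ a b → E2 (a ⊝ b) ≋ E2 a ⊝ E2 b
E2-⊝ a b = ev-od-injective
  (begin
    ev (E2 (a ⊝ b))          ≈⟨ ev-E2 (a ⊝ b) ⟩
    a ⊝ b                    ≈⟨ ⊕-cong (ev-E2 a) (neg-cong (ev-E2 b)) ⟨
    ev (E2 a) ⊝ ev (E2 b)    ∎)
  (begin
    od (E2 (a ⊝ b))          ≈⟨ od-E2 (a ⊝ b) ⟩
    const 0ℤ                 ≈⟨ solve 0 (con 0ℤ := con 0ℤ :- con 0ℤ) ≋-refl ⟩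
    const 0ℤ ⊝ const 0ℤ      ≈⟨ ⊕-cong (od-E2 a) (neg-cong (od-E2 b)) ⟨
    od (E2 a) ⊝ od (E2 b)    ∎)
  where open ≋-Reasoning

E2-const : ∀ c → E2 (const c) ≋ const c
E2-const c = ev-od-injective (≋-trans (ev-E2 (const c)) (≋-sym (ev-const c)))
                             (≋-trans (od-E2 (const c)) (≋-sym (od-const c)))

E2-const· : ∀ c a → E2 (const c · a) ≋ const c · E2 a
E2-const· c a = ≋-trans (E2-· (const c) a) (·-congʳ (E2-const c))

σ-· : ∀ a b → σ (a · b) ≋ σ a · σ b
σ-· a b = ev-od-injective
  (begin
    ev (σ (a · b))                                          ≈⟨ ev-σ (a · b) ⟩
    ev (a · b)                                              ≈⟨ ev-· a b ⟩
    ev a · ev b ⊕ q · (od a · od b)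
      ≈⟨ solve 5 (λ q e o e′ o′ → e :* e′ :+ q :* (o :* o′) := e :* e′ :+ q :* ((:- o) :* (:- o′)))
           ≋-refl q (ev a) (od a) (ev b) (od b) ⟩
    ev a · ev b ⊕ q · (neg (od a) · neg (od b))
      ≈⟨ ⊕-cong (·-cong (ev-σ a) (ev-σ b)) (·-congˡ (·-cong (od-σ a) (od-σ b))) ⟨
    ev (σ a) · ev (σ b) ⊕ q · (od (σ a) · od (σ b))         ≈⟨ ev-· (σ a) (σ b) ⟨
    ev (σ a · σ b)                                          ∎)
  (begin
    od (σ (a · b))                                          ≈⟨ od-σ (a · b) ⟩
    neg (od (a · b))                                        ≈⟨ neg-cong (od-· a b) ⟩
    neg (ev a · od b ⊕ od a · ev b)
      ≈⟨ solve 4 (λ e o e′ o′ → :- (e :* o′ :+ o :* e′) := e :* (:- o′) :+ (:- o) :* e′)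
           ≋-refl (ev a) (od a) (ev b) (od b) ⟩
    ev a · neg (od b) ⊕ neg (od a) · ev b
      ≈⟨ ⊕-cong (·-cong (ev-σ a) (od-σ b)) (·-cong (od-σ a) (ev-σ b)) ⟨
    ev (σ a) · od (σ b) ⊕ od (σ a) · ev (σ b)               ≈⟨ od-· (σ a) (σ b) ⟨
    od (σ a · σ b)                                          ∎)
  where open ≋-Reasoning

-- The norm

-- norm a is a(q) a(-q), expressed in q².
norm : PowerSeries → PowerSeries
norm a = ev a · ev a ⊝ q · (od a · od a)

norm-cong : ∀ {a b} → a ≋ b → norm a ≋ norm b
norm-cong a≋b = ⊕-cong (·-cong (ev-cong a≋b) (ev-cong a≋b))
  (neg-cong (·-congˡ (·-cong (od-cong a≋b) (od-cong a≋b))))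

-- Brahmagupta's composition identity for the quadratic form e² - q o².
norm-· : ∀ a b → norm (a · b) ≋ norm a · norm b
norm-· a b = begin
  norm (a · b)
    ≈⟨ ⊕-cong (·-cong (ev-· a b) (ev-· a b)) (neg-cong (·-congˡ (·-cong (od-· a b) (od-· a b)))) ⟩
  (ev a · ev b ⊕ q · (od a · od b)) · (ev a · ev b ⊕ q · (od a · od b))
    ⊝ q · ((ev a · od b ⊕ od a · ev b) · (ev a · od b ⊕ od a · ev b))
    ≈⟨ solve 5 (λ q e o e′ o′ →
           (e :* e′ :+ q :* (o :* o′)) :* (e :* e′ :+ q :* (o :* o′))
             :- q :* ((e :* o′ :+ o :* e′) :* (e :* o′ :+ o :* e′))
           := (e :* e :- q :* (o :* o)) :* (e′ :* e′ :- q :* (o′ :* o′)))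
         ≋-refl q (ev a) (od a) (ev b) (od b) ⟩
  norm a · norm b ∎
  where open ≋-Reasoning

norm-E2 : ∀ a → norm (E2 a) ≋ a · a
norm-E2 a = begin
  norm (E2 a)
    ≈⟨ ⊕-cong (·-cong (ev-E2 a) (ev-E2 a)) (neg-cong (·-congˡ (·-cong (od-E2 a) (od-E2 a)))) ⟩
  a · a ⊝ q · (const 0ℤ · const 0ℤ)
    ≈⟨ solve 2 (λ q a → a :* a :- q :* (con 0ℤ :* con 0ℤ) := a :* a) ≋-refl q a ⟩
  a · a ∎
  where open ≋-Reasoning

·-σ : ∀ a → a · σ a ≋ E2 (norm a)
·-σ a = ev-od-injective
  (begin
    ev (a · σ a)                                ≈⟨ ev-· a (σ a) ⟩
    ev a · ev (σ a) ⊕ q · (od a · od (σ a))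
      ≈⟨ ⊕-cong (·-congˡ (ev-σ a)) (·-congˡ (·-congˡ (od-σ a))) ⟩
    ev a · ev a ⊕ q · (od a · neg (od a))
      ≈⟨ solve 3 (λ q e o → e :* e :+ q :* (o :* (:- o))
           := e :* e :- q :* (o :* o)) ≋-refl q (ev a) (od a) ⟩
    norm a                                      ≈⟨ ev-E2 (norm a) ⟨
    ev (E2 (norm a))                            ∎)
  (begin
    od (a · σ a)                                ≈⟨ od-· a (σ a) ⟩
    ev a · od (σ a) ⊕ od a · ev (σ a)
      ≈⟨ ⊕-cong (·-congˡ (od-σ a)) (·-congˡ (ev-σ a)) ⟩
    ev a · neg (od a) ⊕ od a · ev a
      ≈⟨ solve 2 (λ e o → e :* (:- o) :+ o :* e := con 0ℤ) ≋-refl (ev a) (od a) ⟩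
    const 0ℤ                                    ≈⟨ od-E2 (norm a) ⟨
    od (E2 (norm a))                            ∎)
  where open ≋-Reasoning

⊕-σ : ∀ a → a ⊕ σ a ≋ const (+ 2) · E2 (ev a)
⊕-σ a = ev-od-injective
  (begin
    ev a ⊕ ev (σ a)                    ≈⟨ ⊕-cong (≋-refl {ev a}) (ev-σ a) ⟩
    ev a ⊕ ev a                        ≈⟨ solve 1 (λ e → e :+ e := con (+ 2) :* e) ≋-refl (ev a) ⟩
    const (+ 2) · ev a                 ≈⟨ ·-congˡ (ev-E2 (ev a)) ⟨
    const (+ 2) · ev (E2 (ev a))       ≈⟨ ev-const· (+ 2) (E2 (ev a)) ⟨
    ev (const (+ 2) · E2 (ev a))       ∎)
  (begin
    od a ⊕ od (σ a)                    ≈⟨ ⊕-cong (≋-refl {od a}) (od-σ a) ⟩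
    od a ⊕ neg (od a)
      ≈⟨ solve 1 (λ o → o :+ (:- o) := con (+ 2) :* con 0ℤ) ≋-refl (od a) ⟩
    const (+ 2) · const 0ℤ             ≈⟨ ·-congˡ (od-E2 (ev a)) ⟨
    const (+ 2) · od (E2 (ev a))       ≈⟨ od-const· (+ 2) (E2 (ev a)) ⟨
    od (const (+ 2) · E2 (ev a))       ∎)
  where open ≋-Reasoning

⊝-σ : ∀ a → a ⊝ σ a ≋ const (+ 2) · (q · E2 (od a))
⊝-σ a = ev-od-injective
  (begin
    ev a ⊝ ev (σ a)                    ≈⟨ ⊕-cong (≋-refl {ev a}) (neg-cong (ev-σ a)) ⟩
    ev a ⊝ ev a
      ≈⟨ solve 2 (λ q e → e :- e := con (+ 2) :* (q :* con 0ℤ)) ≋-refl q (ev a) ⟩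
    const (+ 2) · (q · const 0ℤ)
      ≈⟨ ·-congˡ (·-congˡ (od-E2 (od a))) ⟨
    const (+ 2) · (q · od (E2 (od a)))
      ≈⟨ ·-congˡ (ev-q· (E2 (od a))) ⟨
    const (+ 2) · ev (q · E2 (od a))   ≈⟨ ev-const· (+ 2) (q · E2 (od a)) ⟨
    ev (const (+ 2) · (q · E2 (od a))) ∎)
  (begin
    od a ⊝ od (σ a)                    ≈⟨ ⊕-cong (≋-refl {od a}) (neg-cong (od-σ a)) ⟩
    od a ⊝ neg (od a)                  ≈⟨ solve 1 (λ o → o :- (:- o) := con (+ 2) :* o) ≋-refl (od a) ⟩
    const (+ 2) · od a                 ≈⟨ ·-congˡ (ev-E2 (od a)) ⟨
    const (+ 2) · ev (E2 (od a))       ≈⟨ ·-congˡ (od-q· (E2 (od a))) ⟨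
    const (+ 2) · od (q · E2 (od a))   ≈⟨ od-const· (+ 2) (q · E2 (od a)) ⟨
    od (const (+ 2) · (q · E2 (od a))) ∎)
  where open ≋-Reasoning

-- Powers, inverses and cancellation

infixr 8 _↑_

opaque
  unfolding _·_

  _↑_ : PowerSeries → ℕ → PowerSeries
  _↑_ = pow

  ↑≋pow : ∀ a n → a ↑ n ≋ pow a n
  ↑≋pow a n = ≋-refl

  pow-zero : ∀ a → a ↑ 0 ≋ one
  pow-zero a = ≋-refl

  pow-suc : ∀ a n → a ↑ suc n ≋ a · a ↑ n
  pow-suc a n = ≋-refl

  pow-at-0 : ∀ a n → a 0 ≡ 1ℤ → (a ↑ n) 0 ≡ 1ℤ
  pow-at-0 a zero    a₀≡1 = refl
  pow-at-0 a (suc n) a₀≡1 = cong₂ (λ x y → x * y + 0ℤ) a₀≡1 (pow-at-0 a n a₀≡1)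

  -- The constant term of the odd part of f₁⁸, which selects -8 f₂⁸ among the candidate solutions of
  -- its functional equation.
  f₁⁸-at-1 : (f 1 ↑ 8) 1 ≡ - + 8
  f₁⁸-at-1 = refl

pow-cong : ∀ {a b} n → a ≋ b → a ↑ n ≋ b ↑ n
pow-cong {a} {b} zero    a≋b = ≋-trans (pow-zero a) (≋-sym (pow-zero b))
pow-cong {a} {b} (suc n) a≋b =
  ≋-trans (pow-suc a n) (≋-trans (·-cong a≋b (pow-cong n a≋b)) (≋-sym (pow-suc b n)))

pow-· : ∀ a b n → (a · b) ↑ n ≋ a ↑ n · b ↑ n
pow-· a b zero    = begin
  (a · b) ↑ 0          ≈⟨ pow-zero (a · b) ⟩
  one                  ≈⟨ ·-identityˡ one ⟨
  one · one            ≈⟨ ·-cong (pow-zero a) (pow-zero b) ⟨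
  a ↑ 0 · b ↑ 0        ∎
  where open ≋-Reasoning
pow-· a b (suc n) = begin
  (a · b) ↑ (suc n)              ≈⟨ pow-suc (a · b) n ⟩
  (a · b) · (a · b) ↑ n          ≈⟨ ·-congˡ (pow-· a b n) ⟩
  (a · b) · (a ↑ n · b ↑ n)
    ≈⟨ solve 4 (λ a b x y → (a :* b) :* (x :* y) := (a :* x) :* (b :* y)) ≋-refl a b (a ↑ n) (b ↑ n) ⟩
  (a · a ↑ n) · (b · b ↑ n)    ≈⟨ ·-cong (pow-suc a n) (pow-suc b n) ⟨
  a ↑ (suc n) · b ↑ (suc n)    ∎
  where open ≋-Reasoning

pow-one : ∀ n → one ↑ n ≋ one
pow-one zero    = pow-zero one
pow-one (suc n) = ≋-trans (pow-suc one n) (≋-trans (·-identityˡ (one ↑ n)) (pow-one n))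

E2-one : E2 one ≋ one
E2-one = ≋-trans (E2-cong one≋const) (≋-trans (E2-const 1ℤ) (≋-sym one≋const))

E2-pow : ∀ a n → E2 (a ↑ n) ≋ (E2 a) ↑ n
E2-pow a zero    = ≋-trans (E2-cong (pow-zero a)) (≋-trans E2-one (≋-sym (pow-zero (E2 a))))
E2-pow a (suc n) = begin
  E2 (a ↑ (suc n))         ≈⟨ E2-cong (pow-suc a n) ⟩
  E2 (a · a ↑ n)           ≈⟨ E2-· a (a ↑ n) ⟩
  E2 a · E2 (a ↑ n)        ≈⟨ ·-congˡ (E2-pow a n) ⟩
  E2 a · (E2 a) ↑ n        ≈⟨ pow-suc (E2 a) n ⟨
  (E2 a) ↑ (suc n)         ∎
  where open ≋-Reasoning

norm-one : norm one ≋ one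
norm-one = begin
  norm one         ≈⟨ norm-cong E2-one ⟨
  norm (E2 one)    ≈⟨ norm-E2 one ⟩
  one · one        ≈⟨ ·-identityˡ one ⟩
  one              ∎
  where open ≋-Reasoning

norm-pow : ∀ a n → norm (a ↑ n) ≋ (norm a) ↑ n
norm-pow a zero    = ≋-trans (norm-cong (pow-zero a)) (≋-trans norm-one (≋-sym (pow-zero (norm a))))
norm-pow a (suc n) = begin
  norm (a ↑ (suc n))       ≈⟨ norm-cong (pow-suc a n) ⟩
  norm (a · a ↑ n)         ≈⟨ norm-· a (a ↑ n) ⟩
  norm a · norm (a ↑ n)    ≈⟨ ·-congˡ (norm-pow a n) ⟩
  norm a · (norm a) ↑ n    ≈⟨ pow-suc (norm a) n ⟨
  (norm a) ↑ (suc n)       ∎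
  where open ≋-Reasoning

·-inv : ∀ a → a 0 ≡ 1ℤ → a · inv a ≋ one
·-inv a a₀≡1 = ≋-trans (·≋⊛ a (inv a)) (mk≋ (inv-inverseʳ a a₀≡1))

·-cancelˡ : ∀ a {b c} → a 0 ≡ 1ℤ → a · b ≋ a · c → b ≋ c
·-cancelˡ a {b} {c} a₀≡1 ab≋ac = begin
  b                    ≈⟨ ·-identityˡ b ⟨
  one · b              ≈⟨ ·-congʳ (·-inv a a₀≡1) ⟨
  (a · inv a) · b      ≈⟨ rearrange b ⟩
  inv a · (a · b)      ≈⟨ ·-congˡ ab≋ac ⟩
  inv a · (a · c)      ≈⟨ rearrange c ⟨
  (a · inv a) · c      ≈⟨ ·-congʳ (·-inv a a₀≡1) ⟩
  one · c              ≈⟨ ·-identityˡ c ⟩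
  c                    ∎
  where
  open ≋-Reasoning
  rearrange : ∀ b → (a · inv a) · b ≋ inv a · (a · b)
  rearrange = solve 3 (λ a i b → (a :* i) :* b := i :* (a :* b)) ≋-refl a (inv a)

-- Agreement up to a given coefficient

infix 4 _≈[_]_

-- Congruence modulo q^(n+1), the precision to which finite products and sums approximate infinite
-- ones.
_≈[_]_ : PowerSeries → ℕ → PowerSeries → Set
a ≈[ n ] b = ∀ i → i ≤ n → a i ≡ b i

≋⇒≈[] : ∀ {a b n} → a ≋ b → a ≈[ n ] b
≋⇒≈[] a≋b i _ = at a≋b i

·-cong-≈[] : ∀ {a a′ b b′ n} → a ≈[ n ] a′ → b ≈[ n ] b′ → a · b ≈[ n ] a′ · b′
·-cong-≈[] a≈ b≈ i i≤n = ·-local i (λ j j≤i → a≈ j (ℕₚ.≤-trans j≤i i≤n))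
                                   (λ j j≤i → b≈ j (ℕₚ.≤-trans j≤i i≤n))

n≤double : ∀ n → n ≤ double n
n≤double zero    = z≤n
n≤double (suc n) = s≤s (ℕₚ.m≤n⇒m≤1+n (n≤double n))

double-mono-≤ : ∀ {m n} → m ≤ n → double m ≤ double n
double-mono-≤ z≤n       = z≤n
double-mono-≤ (s≤s m≤n) = s≤s (s≤s (double-mono-≤ m≤n))

-- The norm is written in q², so precision n costs about twice as much in the argument;
-- `double (suc n)` covers the odd index 2n + 1.
norm-cong-≈[] : ∀ {a b n} → a ≈[ double (suc n) ] b → norm a ≈[ n ] norm b
norm-cong-≈[] a≈b i i≤n = cong₂ _-_
  (·-cong-≈[] ev≈ ev≈ i i≤n)
  (·-cong-≈[] (≋⇒≈[] (≋-refl {q})) (·-cong-≈[] od≈ od≈) i i≤n)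
  where
  ev≈ = λ i i≤n → a≈b (double i) (double-mono-≤ (ℕₚ.m≤n⇒m≤1+n i≤n))
  od≈ = λ i i≤n → a≈b (suc (double i)) (ℕₚ.<⇒≤ (double-mono-≤ (s≤s i≤n)))

-- Dissection and norm of the factors 1 - q^d

double≡*2 : ∀ n → n ℕ.* 2 ≡ double n
double≡*2 zero    = refl
double≡*2 (suc n) = cong (λ m → suc (suc m)) (double≡*2 n)

n+n≡double : ∀ n → n ℕ.+ n ≡ double n
n+n≡double zero    = refl
n+n≡double (suc n) = cong suc (trans (ℕₚ.+-suc n n) (cong suc (n+n≡double n)))

ev-X^double : ∀ d → ev (X^ (double d)) ≋ X^ d
ev-X^double d .at = go d
  where
  go : ∀ d n → X^ (double d) (double n) ≡ X^ d n
  go zero    zero    = refl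
  go zero    (suc n) = refl
  go (suc d) zero    = refl
  go (suc d) (suc n) = go d n

const-0 : ∀ n → const 0ℤ n ≡ 0ℤ
const-0 zero    = refl
const-0 (suc n) = refl

od-X^double : ∀ d → od (X^ (double d)) ≋ const 0ℤ
od-X^double d .at n = trans (go d n) (sym (const-0 n))
  where
  go : ∀ d n → X^ (double d) (suc (double n)) ≡ 0ℤ
  go zero    n       = refl
  go (suc d) zero    = refl
  go (suc d) (suc n) = go d n

X^double≋E2 : ∀ d → X^ (double d) ≋ E2 (X^ d)
X^double≋E2 d = ev-od-injective (≋-trans (ev-X^double d) (≋-sym (ev-E2 (X^ d))))
                                (≋-trans (od-X^double d) (≋-sym (od-E2 (X^ d))))

ev-X^suc-double : ∀ d → ev (X^ (suc (double d))) ≋ const 0ℤ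
ev-X^suc-double d = begin
  ev (X^ (suc (double d)))   ≈⟨ ev-cong (X^-suc (double d)) ⟩
  ev (q · X^ (double d))     ≈⟨ ev-q· (X^ (double d)) ⟩
  q · od (X^ (double d))     ≈⟨ ·-congˡ (od-X^double d) ⟩
  q · const 0ℤ               ≈⟨ solve 1 (λ q → q :* con 0ℤ := con 0ℤ) ≋-refl q ⟩
  const 0ℤ                   ∎
  where open ≋-Reasoning

od-X^suc-double : ∀ d → od (X^ (suc (double d))) ≋ X^ d
od-X^suc-double d = ev-X^double d

X^d² : ∀ d → X^ d · X^ d ≋ X^ (double d)
X^d² d = begin
  X^ d · X^ d      ≈⟨ X^-+ d d ⟨
  X^ (d ℕ.+ d)     ≡⟨ cong X^ (n+n≡double d) ⟩
  X^ (double d)    ∎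
  where open ≋-Reasoning

-- For odd m, (1 - q^m)(1 + q^m) = 1 - q^(2m), which in the variable q² is the original factor
-- again.
norm-[1-X^suc-double] : ∀ d → norm (one ⊝ X^ (suc (double d))) ≋ one ⊝ X^ (suc (double d))
norm-[1-X^suc-double] d = begin
  norm (one ⊝ X^ (suc (double d)))
    ≈⟨ ⊕-cong (·-cong ev≋ ev≋) (neg-cong (·-congˡ (·-cong od≋ od≋))) ⟩
  one · one ⊝ q · (neg (X^ d) · neg (X^ d))
    ≈⟨ solve 3 (λ i q x → i :* i :- q :* ((:- x) :* (:- x))
         := i :* i :- q :* (x :* x)) ≋-refl one q (X^ d) ⟩
  one · one ⊝ q · (X^ d · X^ d)
    ≈⟨ ⊕-cong (·-identityˡ one) (neg-cong (·-congˡ (X^d² d))) ⟩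
  one ⊝ q · X^ (double d)
    ≈⟨ ⊕-cong (≋-refl {one}) (neg-cong (X^-suc (double d))) ⟨
  one ⊝ X^ (suc (double d)) ∎
  where
  open ≋-Reasoning
  ev≋ : ev (one ⊝ X^ (suc (double d))) ≋ one
  ev≋ = begin
    ev one ⊝ ev (X^ (suc (double d)))  ≈⟨ ⊕-cong (ev-X^double 0) (neg-cong (ev-X^suc-double d)) ⟩
    one ⊝ const 0ℤ                     ≈⟨ solve 1 (λ i → i :- con 0ℤ := i) ≋-refl one ⟩
    one                                ∎
  od≋ : od (one ⊝ X^ (suc (double d))) ≋ neg (X^ d)
  od≋ = begin
    od one ⊝ od (X^ (suc (double d)))  ≈⟨ ⊕-cong (od-X^double 0) (neg-cong (od-X^suc-double d)) ⟩
    const 0ℤ ⊝ X^ d                    ≈⟨ solve 1 (λ x → con 0ℤ :- x := :- x) ≋-refl (X^ d) ⟩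
    neg (X^ d)                         ∎

1-X^double≋E2 : ∀ d → one ⊝ X^ (double d) ≋ E2 (one ⊝ X^ d)
1-X^double≋E2 d = begin
  one ⊝ X^ (double d)      ≈⟨ ⊕-cong (≋-sym E2-one) (neg-cong (X^double≋E2 d)) ⟩
  E2 one ⊝ E2 (X^ d)       ≈⟨ E2-⊝ one (X^ d) ⟨
  E2 (one ⊝ X^ d)          ∎
  where open ≋-Reasoning

-- A factor with even exponent is invariant under q ↦ -q, so its norm is a square.
norm-[1-X^double] : ∀ d → norm (one ⊝ X^ (double d)) ≋ (one ⊝ X^ d) · (one ⊝ X^ d)
norm-[1-X^double] d = ≋-trans (norm-cong (1-X^double≋E2 d)) (norm-E2 (one ⊝ X^ d))

-- The norm of f₁

P₁ P₂ : ℕ → PowerSeries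
P₁ = partialProduct 1
P₂ = partialProduct 2

P₁-suc : ∀ N → P₁ (suc N) ≋ (one ⊝ X^ (suc N)) · P₁ N
P₁-suc N = ≋-trans (≋-sym (·≋⊛ (one ⊝ X^ (suc N ℕ.* 1)) (P₁ N)))
  (mk≋ λ m → cong (λ d → ((one ⊝ X^ d) · P₁ N) m) (ℕₚ.*-identityʳ (suc N)))

P₂-suc : ∀ N → P₂ (suc N) ≋ (one ⊝ X^ (double (suc N))) · P₂ N
P₂-suc N = ≋-trans (≋-sym (·≋⊛ (one ⊝ X^ (suc N ℕ.* 2)) (P₂ N)))
  (mk≋ λ m → cong (λ d → ((one ⊝ X^ d) · P₂ N) m) (double≡*2 (suc N)))

P₁-f : ∀ N → P₁ N ≈[ N ] f 1
P₁-f N = f-limit 1 N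

P₂-f : ∀ N → P₂ N ≈[ N ] f 2
P₂-f N = f-limit 2 N

P₂≋E2 : ∀ N → P₂ N ≋ E2 (P₁ N)
P₂≋E2 zero    = ≋-sym E2-one
P₂≋E2 (suc N) = begin
  P₂ (suc N)                                  ≈⟨ P₂-suc N ⟩
  (one ⊝ X^ (double (suc N))) · P₂ N          ≈⟨ ·-cong (1-X^double≋E2 (suc N)) (P₂≋E2 N) ⟩
  E2 (one ⊝ X^ (suc N)) · E2 (P₁ N)           ≈⟨ E2-· (one ⊝ X^ (suc N)) (P₁ N) ⟨
  E2 ((one ⊝ X^ (suc N)) · P₁ N)              ≈⟨ E2-cong (P₁-suc N) ⟨
  E2 (P₁ (suc N))                             ∎
  where open ≋-Reasoning

f₂≋E2f₁ : f 2 ≋ E2 (f 1)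
f₂≋E2f₁ .at m = trans (at (P₂≋E2 m) m) (merge-local m (P₁-f m) (λ _ _ → refl))

-- Induction step of `norm-P₁`, with y, z, w in place of 1 - q^(N+1), 1 - q^(2N+1), 1 - q^(2N+2):
-- the two new factors have norms z and y², and the w contributed by `P₂` joins z to form the new
-- factors of `P₁`.
norm-product-step : ∀ {y z w p p′ P P′ r r′} → norm z ≋ z → norm w ≋ y · y →
  p′ ≋ y · p → P′ ≋ w · (z · P) → r′ ≋ w · r →
  norm P · r ≋ (p · p) · P → norm P′ · r′ ≋ (p′ · p′) · P′
norm-product-step {y} {z} {w} {p} {p′} {P} {P′} {r} {r′} norm-z norm-w p′≋ P′≋ r′≋ ih = begin
  norm P′ · r′                                   ≈⟨ ·-cong (norm-cong P′≋) r′≋ ⟩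
  norm (w · (z · P)) · (w · r)
    ≈⟨ ·-congʳ (≋-trans (norm-· w (z · P)) (·-congˡ (norm-· z P))) ⟩
  (norm w · (norm z · norm P)) · (w · r)
    ≈⟨ ·-congʳ (·-cong norm-w (·-congʳ norm-z)) ⟩
  ((y · y) · (z · norm P)) · (w · r)
    ≈⟨ solve 5 (λ y z w nP r → ((y :* y) :* (z :* nP)) :* (w :* r) := (y :* y :* (z :* w)) :* (nP :* r))
         ≋-refl y z w (norm P) r ⟩
  (y · y · (z · w)) · (norm P · r)               ≈⟨ ·-congˡ ih ⟩
  (y · y · (z · w)) · ((p · p) · P)
    ≈⟨ solve 5 (λ y z w p P → (y :* y :* (z :* w)) :* ((p :* p) :* P)
         := ((y :* p) :* (y :* p)) :* (w :* (z :* P)))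
         ≋-refl y z w p P ⟩
  ((y · p) · (y · p)) · (w · (z · P))            ≈⟨ ·-cong (·-cong p′≋ p′≋) P′≋ ⟨
  (p′ · p′) · P′                                 ∎
  where open ≋-Reasoning

-- In the norm of `P₁ (double N)` the odd factors reproduce themselves and the even ones give the
-- square of `P₁ N`. Multiplying by `P₂ N` restores the missing even factors.
norm-P₁ : ∀ N → norm (P₁ (double N)) · P₂ N ≋ (P₁ N · P₁ N) · P₁ (double N)
norm-P₁ zero    = ≋-trans (·-congʳ norm-one) (≋-sym (·-congʳ (·-identityˡ one)))
norm-P₁ (suc N) = norm-product-step
  (norm-[1-X^suc-double] N) (norm-[1-X^double] (suc N)) (P₁-suc N)
  (≋-trans (P₁-suc (suc (double N))) (·-congˡ (P₁-suc (double N))))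
  (P₂-suc N) (norm-P₁ N)

norm-f₁ : norm (f 1) · f 2 ≋ (f 1 · f 1) · f 1
norm-f₁ .at m = begin
  (norm (f 1) · f 2) m
    ≡⟨ ·-cong-≈[] (norm-cong-≈[] (P₁-f (double N))) (λ i i≤m → P₂-f N i (m≤n⇒m≤1+n i≤m)) m ≤-refl ⟨
  (norm (P₁ (double N)) · P₂ N) m         ≡⟨ at (norm-P₁ N) m ⟩
  ((P₁ N · P₁ N) · P₁ (double N)) m
    ≡⟨ ·-cong-≈[] (·-cong-≈[] P₁N P₁N) (λ i i≤m → P₁-f (double N) i (≤-trans (m≤n⇒m≤1+n i≤m) (n≤double N))) m ≤-refl ⟩
  ((f 1 · f 1) · f 1) m                   ∎
  where
  open ≡-Reasoning
  open ℕₚ using (m≤n⇒m≤1+n; ≤-trans; ≤-refl)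
  N : ℕ
  -- `norm-cong-≈[]` at m asks for precision `double (suc m)`, which is that of `P₁ (double N)`.
  N = suc m
  P₁N : P₁ N ≈[ m ] f 1
  P₁N i i≤m = P₁-f N i (m≤n⇒m≤1+n i≤m)

-- The theta series and Gauss's formula

sign : ℕ → ℤ
sign zero    = 1ℤ
sign (suc n) = - sign n

Θ-partial : ℕ → PowerSeries
Θ-partial zero    = one
Θ-partial (suc n) = Θ-partial n ⊕ const (+ 2 * sign (suc n)) · X^ (suc n ℕ.* suc n)

-- Θ = 1 + 2 ∑_{n ≥ 1} (-1)ⁿ q^{n²}.
Θ : PowerSeries
Θ m = Θ-partial m m

X^·-low : ∀ d a m → m < d → (X^ d · a) m ≡ 0ℤ
X^·-low (suc d) a zero    _         = begin
  (X^ (suc d) · a) 0      ≡⟨ at (·-congʳ (X^-suc d)) 0 ⟩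
  ((q · X^ d) · a) 0      ≡⟨ at (·-assoc q (X^ d) a) 0 ⟩
  (q · (X^ d · a)) 0      ≡⟨ q·-zero (X^ d · a) ⟩
  0ℤ                      ∎
  where open ≡-Reasoning
X^·-low (suc d) a (suc m) (s≤s m<d) = begin
  (X^ (suc d) · a) (suc m)      ≡⟨ at (·-congʳ (X^-suc d)) (suc m) ⟩
  ((q · X^ d) · a) (suc m)      ≡⟨ at (·-assoc q (X^ d) a) (suc m) ⟩
  (q · (X^ d · a)) (suc m)      ≡⟨ q·-suc (X^ d · a) m ⟩
  (X^ d · a) m                  ≡⟨ X^·-low d a m m<d ⟩
  0ℤ                            ∎
  where open ≡-Reasoning

Θ-partial-stable : ∀ n → Θ-partial n ≈[ n ] Θ
Θ-partial-stable zero    zero z≤n = refl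
Θ-partial-stable (suc n) m m≤1+n with m ℕ.≟ suc n
... | yes refl = refl
... | no m≢1+n = begin
  Θ-partial n m + (const c · X^ (suc n ℕ.* suc n)) m
    ≡⟨ +-congˡ (Θ-partial n m) (trans (const-· c (X^ (suc n ℕ.* suc n)) m) (trans (cong (c *_) X^≡0) (ℤₚ.*-zeroʳ c))) ⟩
  Θ-partial n m + 0ℤ     ≡⟨ ℤₚ.+-identityʳ _ ⟩
  Θ-partial n m          ≡⟨ Θ-partial-stable n m (ℕₚ.≤-pred m<1+n) ⟩
  Θ m                    ∎
  where
  open ≡-Reasoning
  c : ℤ
  c = + 2 * sign (suc n)
  m<1+n : m < suc n
  m<1+n = ℕₚ.≤∧≢⇒< m≤1+n m≢1+n
  X^≡0 : X^ (suc n ℕ.* suc n) m ≡ 0ℤ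
  X^≡0 = X^-off (ℕₚ.>⇒≢ (ℕₚ.<-≤-trans m<1+n (ℕₚ.m≤m*n (suc n) (suc n))))

-- Gauss's identity f₁² = f₂ Θ, by Shanks's finite sums
--   H (n+1) n = ∑_{s ≤ n} q^{s(n+1)} G s ∏_{s < r ≤ n} (1 - q^r) = Θ-partial n ∏_{r ≤ n} (1 + q^r),
-- whose terms with s ≥ 1 do not contribute to the coefficients up to q^n.

G : ℕ → PowerSeries
G zero    = one
G (suc s) = neg ((one ⊕ X^ s) · G s)

H : ℕ → ℕ → PowerSeries
H p zero    = one
H p (suc j) = (one ⊝ X^ (suc j)) · H p j ⊕ X^ (suc j ℕ.* p) · G (suc j)

D : ℕ → PowerSeries
D zero    = one
D (suc n) = (one ⊕ X^ (suc n)) · D n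

-- The product in `G` starts at r = 0 with the factor 1 + q^0 = 2; this is where the 2 in the theta
-- series comes from.
G≋D : ∀ n → G (suc n) ≋ const (+ 2 * sign (suc n)) · D n
G≋D zero = solve 0 (:- ((:1 :+ :1) :* :1) := con (- + 2) :* :1) ≋-refl
G≋D (suc n) = begin
  neg ((one ⊕ X^ (suc n)) · G (suc n))
    ≈⟨ neg-cong (·-congˡ (G≋D n)) ⟩
  neg ((one ⊕ X^ (suc n)) · (const (+ 2 * sign (suc n)) · D n))
    ≈⟨ solve 3 (λ x c d → :- (x :* (c :* d)) := (:- c) :* (x :* d)) ≋-refl
         (one ⊕ X^ (suc n)) (const (+ 2 * sign (suc n))) (D n) ⟩
  neg (const (+ 2 * sign (suc n))) · D (suc n)
    ≈⟨ ·-congʳ (_-Raw-AlmostCommutative⟶_.-‿homo const-homomorphism (+ 2 * sign (suc n))) ⟨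
  const (- (+ 2 * sign (suc n))) · D (suc n)
    ≡⟨ cong (λ c → const c · D (suc n)) (ℤₚ.neg-distribʳ-* (+ 2) (sign (suc n))) ⟩
  const (+ 2 * sign (suc (suc n))) · D (suc n) ∎
  where open ≋-Reasoning

-- Induction step of `H-telescope`, with x, y, z in place of q^n, q^(j+1), q^((j+1)n) and Q, Q′ in
-- place of consecutive values of `G`. Then y z = q^((j+1)(n+1)) and x z = q^((j+2)n).
H-step : ∀ {x y z Q Q′ h h′} → Q′ ≋ neg ((one ⊕ y) · Q) → (one ⊝ x) · h ≋ (one ⊕ x) · h′ ⊕ z · Q →
  (one ⊝ x) · ((one ⊝ y) · h ⊕ (y · z) · Q) ≋ (one ⊕ x) · ((one ⊝ y) · h′ ⊕ z · Q) ⊕ (x · z) · Q′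
H-step {x} {y} {z} {Q} {Q′} {h} {h′} Q′≋ ih = begin
  (one ⊝ x) · ((one ⊝ y) · h ⊕ (y · z) · Q)
    ≈⟨ solve 5 (λ x y z Q h → (:1 :- x) :* ((:1 :- y) :* h :+ (y :* z) :* Q)
         := (:1 :- y) :* ((:1 :- x) :* h) :+ (:1 :- x) :* ((y :* z) :* Q)) ≋-refl x y z Q h ⟩
  (one ⊝ y) · ((one ⊝ x) · h) ⊕ (one ⊝ x) · ((y · z) · Q)
    ≈⟨ ⊕-cong (·-congˡ ih) (≋-refl {(one ⊝ x) · ((y · z) · Q)}) ⟩
  (one ⊝ y) · ((one ⊕ x) · h′ ⊕ z · Q) ⊕ (one ⊝ x) · ((y · z) · Q)
    ≈⟨ solve 5 (λ x y z Q h′ → (:1 :- y) :* ((:1 :+ x) :* h′ :+ z :* Q) :+ (:1 :- x) :* ((y :* z) :* Q)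
         := (:1 :+ x) :* ((:1 :- y) :* h′ :+ z :* Q) :+ (x :* z) :* (:- ((:1 :+ y) :* Q)))
         ≋-refl x y z Q h′ ⟩
  (one ⊕ x) · ((one ⊝ y) · h′ ⊕ z · Q) ⊕ (x · z) · neg ((one ⊕ y) · Q)
    ≈⟨ ⊕-cong (≋-refl {(one ⊕ x) · ((one ⊝ y) · h′ ⊕ z · Q)}) (·-congˡ Q′≋) ⟨
  (one ⊕ x) · ((one ⊝ y) · h′ ⊕ z · Q) ⊕ (x · z) · Q′ ∎
  where open ≋-Reasoning

-- Raising the parameter of `H` from n to n + 1 multiplies the sum by (1 + q^n) / (1 - q^n), up to a
-- single boundary term: the contributions of all smaller s telescope.
H-telescope : ∀ n j → (one ⊝ X^ n) · H (suc n) j ≋ (one ⊕ X^ n) · H n j ⊕ X^ (suc j ℕ.* n) · G (suc j)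
H-telescope n zero = begin
  (one ⊝ X^ n) · one
    ≈⟨ solve 1 (λ x → (:1 :- x) :* :1 := (:1 :+ x) :* :1 :+ x :* (:- ((:1 :+ :1) :* :1))) ≋-refl (X^ n) ⟩
  (one ⊕ X^ n) · one ⊕ X^ n · G 1
    ≡⟨ cong (λ d → (one ⊕ X^ n) · one ⊕ X^ d · G 1) (ℕₚ.*-identityˡ n) ⟨
  (one ⊕ X^ n) · one ⊕ X^ (1 ℕ.* n) · G 1     ∎
  where open ≋-Reasoning
H-telescope n (suc j) = begin
  (one ⊝ X^ n) · ((one ⊝ X^ (suc j)) · H (suc n) j ⊕ X^ (suc j ℕ.* suc n) · G (suc j))
    ≈⟨ ·-congˡ (⊕-cong (≋-refl {(one ⊝ X^ (suc j)) · H (suc n) j}) (·-congʳ X^[1+j][1+n])) ⟩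
  (one ⊝ X^ n) · ((one ⊝ X^ (suc j)) · H (suc n) j ⊕ (X^ (suc j) · X^ (suc j ℕ.* n)) · G (suc j))
    ≈⟨ H-step (≋-refl {G (suc (suc j))}) (H-telescope n j) ⟩
  (one ⊕ X^ n) · H n (suc j) ⊕ (X^ n · X^ (suc j ℕ.* n)) · G (suc (suc j))
    ≈⟨ ⊕-cong (≋-refl {(one ⊕ X^ n) · H n (suc j)}) (·-congʳ (X^-+ n (suc j ℕ.* n))) ⟨
  (one ⊕ X^ n) · H n (suc j) ⊕ X^ (suc (suc j) ℕ.* n) · G (suc (suc j)) ∎
  where
  open ≋-Reasoning
  X^[1+j][1+n] : X^ (suc j ℕ.* suc n) ≋ X^ (suc j) · X^ (suc j ℕ.* n)
  X^[1+j][1+n] = begin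
    X^ (suc j ℕ.* suc n)            ≡⟨ cong X^ (ℕₚ.*-suc (suc j) n) ⟩
    X^ (suc j ℕ.+ suc j ℕ.* n)      ≈⟨ X^-+ (suc j) (suc j ℕ.* n) ⟩
    X^ (suc j) · X^ (suc j ℕ.* n)   ∎

-- The recursion of `H` supplies the factor 1 - q^(n+1) that `H-telescope` asks for. The boundary
-- term and the last summand of `H` differ by the factor q^(n+1), so 1 + q^(n+1) splits off, and
-- `G≋D` identifies the rest as the next theta term.
H≋D·Θ-partial : ∀ n → H (suc n) n ≋ D n · Θ-partial n
H≋D·Θ-partial zero    = solve 0 (:1 := :1 :* :1) ≋-refl
H≋D·Θ-partial (suc n) = begin
  (one ⊝ x) · H (suc (suc n)) n ⊕ X^ (suc n ℕ.* suc (suc n)) · G (suc n)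
    ≈⟨ ⊕-cong (H-telescope (suc n) n) (·-congʳ X^[1+n][2+n]) ⟩
  ((one ⊕ x) · H (suc n) n ⊕ z · G (suc n)) ⊕ (x · z) · G (suc n)
    ≈⟨ solve 4 (λ x z G h → ((:1 :+ x) :* h :+ z :* G) :+ (x :* z) :* G := (:1 :+ x) :* (h :+ z :* G))
         ≋-refl x z (G (suc n)) (H (suc n) n) ⟩
  (one ⊕ x) · (H (suc n) n ⊕ z · G (suc n))
    ≈⟨ ·-congˡ (⊕-cong (H≋D·Θ-partial n) (·-congˡ (G≋D n))) ⟩
  (one ⊕ x) · (D n · Θ-partial n ⊕ z · (c · D n))
    ≈⟨ solve 5 (λ x z c d t → (:1 :+ x) :* (d :* t :+ z :* (c :* d))
         := ((:1 :+ x) :* d) :* (t :+ c :* z))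
         ≋-refl x z c (D n) (Θ-partial n) ⟩
  D (suc n) · Θ-partial (suc n) ∎
  where
  open ≋-Reasoning
  x z c : PowerSeries
  x = X^ (suc n)
  z = X^ (suc n ℕ.* suc n)
  c = const (+ 2 * sign (suc n))
  X^[1+n][2+n] : X^ (suc n ℕ.* suc (suc n)) ≋ x · z
  X^[1+n][2+n] = begin
    X^ (suc n ℕ.* suc (suc n))          ≡⟨ cong X^ (ℕₚ.*-suc (suc n) (suc n)) ⟩
    X^ (suc n ℕ.+ suc n ℕ.* suc n)      ≈⟨ X^-+ (suc n) (suc n ℕ.* suc n) ⟩
    x · z                               ∎

P₁·D : ∀ n → P₁ n · D n ≋ P₂ n
P₁·D zero    = solve 0 (:1 :* :1 := :1) ≋-refl
P₁·D (suc n) = begin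
  P₁ (suc n) · D (suc n)                                ≈⟨ ·-congʳ (P₁-suc n) ⟩
  ((one ⊝ x) · P₁ n) · ((one ⊕ x) · D n)
    ≈⟨ solve 3 (λ x P d → ((:1 :- x) :* P) :* ((:1 :+ x) :* d) := (:1 :- x :* x) :* (P :* d))
         ≋-refl x (P₁ n) (D n) ⟩
  (one ⊝ x · x) · (P₁ n · D n)
    ≈⟨ ·-cong (⊕-cong (≋-refl {one}) (neg-cong (X^d² (suc n)))) (P₁·D n) ⟩
  (one ⊝ X^ (double (suc n))) · P₂ n                    ≈⟨ P₂-suc n ⟨
  P₂ (suc n)                                            ∎
  where
  open ≋-Reasoning
  x : PowerSeries
  x = X^ (suc n)

H-low : ∀ {n p} j → n < p → H p j ≈[ n ] P₁ j
H-low zero n<p i i≤n = refl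
H-low {n} {p} (suc j) n<p i i≤n = begin
  ((one ⊝ X^ (suc j)) · H p j) i + (X^ (suc j ℕ.* p) · G (suc j)) i
    ≡⟨ cong₂ _+_ (·-cong-≈[] (≋⇒≈[] (≋-refl {one ⊝ X^ (suc j)})) (H-low j n<p) i i≤n)
                 (X^·-low (suc j ℕ.* p) (G (suc j)) i i<[1+j]p) ⟩
  ((one ⊝ X^ (suc j)) · P₁ j) i + 0ℤ        ≡⟨ ℤₚ.+-identityʳ _ ⟩
  ((one ⊝ X^ (suc j)) · P₁ j) i             ≡⟨ at (P₁-suc j) i ⟨
  P₁ (suc j) i                              ∎
  where
  open ≡-Reasoning
  i<[1+j]p : i < suc j ℕ.* p
  i<[1+j]p = ℕₚ.<-≤-trans (ℕₚ.≤-<-trans i≤n n<p) (ℕₚ.m≤n*m p (suc j))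

f₁²≋f₂Θ : f 1 · f 1 ≋ f 2 · Θ
f₁²≋f₂Θ .at m = begin
  (f 1 · f 1) m                      ≡⟨ ·-cong-≈[] (P₁-f m) H-f m ℕₚ.≤-refl ⟨
  (P₁ m · H (suc m) m) m             ≡⟨ at P₁·H m ⟩
  (P₂ m · Θ-partial m) m             ≡⟨ ·-cong-≈[] (P₂-f m) (Θ-partial-stable m) m ℕₚ.≤-refl ⟩
  (f 2 · Θ) m                        ∎
  where
  open ≡-Reasoning
  H-f : H (suc m) m ≈[ m ] f 1
  H-f i i≤m = trans (H-low m ℕₚ.≤-refl i i≤m) (P₁-f m i i≤m)
  P₁·H : P₁ m · H (suc m) m ≋ P₂ m · Θ-partial m
  P₁·H = ≋-trans (·-congˡ (H≋D·Θ-partial m))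
    (≋-trans (≋-sym (·-assoc (P₁ m) (D m) (Θ-partial m))) (·-congʳ (P₁·D m)))

-- The even part of the theta series

double-+ : ∀ m n → double m ℕ.+ double n ≡ double (m ℕ.+ n)
double-+ zero    n = refl
double-+ (suc m) n = cong (λ k → suc (suc k)) (double-+ m n)

double-* : ∀ m n → double m ℕ.* n ≡ double (m ℕ.* n)
double-* m n = begin
  double m ℕ.* n            ≡⟨ cong (ℕ._* n) (double≡*2 m) ⟨
  m ℕ.* 2 ℕ.* n             ≡⟨ ℕₚ.*-assoc m 2 n ⟩
  m ℕ.* (2 ℕ.* n)           ≡⟨ cong (m ℕ.*_) (ℕₚ.*-comm 2 n) ⟩
  m ℕ.* (n ℕ.* 2)           ≡⟨ ℕₚ.*-assoc m n 2 ⟨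
  m ℕ.* n ℕ.* 2             ≡⟨ double≡*2 (m ℕ.* n) ⟩
  double (m ℕ.* n)          ∎
  where open ≡-Reasoning

double² : ∀ n → double n ℕ.* double n ≡ double (double (n ℕ.* n))
double² n = begin
  double n ℕ.* double n       ≡⟨ double-* n (double n) ⟩
  double (n ℕ.* double n)     ≡⟨ cong double (ℕₚ.*-comm n (double n)) ⟩
  double (double n ℕ.* n)     ≡⟨ cong double (double-* n n) ⟩
  double (double (n ℕ.* n))   ∎
  where open ≡-Reasoning

[1+double]² : ∀ n → suc (double n) ℕ.* suc (double n) ≡ suc (double (n ℕ.+ n ℕ.* suc (double n)))
[1+double]² n =
  cong suc (trans (cong (double n ℕ.+_) (double-* n (suc (double n)))) (double-+ n (n ℕ.* suc (double n))))

sign-double : ∀ n → sign (double n) ≡ 1ℤ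
sign-double zero    = refl
sign-double (suc n) = trans (ℤₚ.neg-involutive (sign (double n))) (sign-double n)

sign-+ : ∀ m n → sign (m ℕ.+ n) ≡ sign m * sign n
sign-+ zero    n = sym (ℤₚ.*-identityˡ (sign n))
sign-+ (suc m) n = trans (cong -_ (sign-+ m n)) (ℤₚ.neg-distribˡ-* (sign m) (sign n))

sign² : ∀ n → sign n * sign n ≡ 1ℤ
sign² n = trans (sym (sign-+ n n)) (trans (cong sign (n+n≡double n)) (sign-double n))

-- n² and n have the same parity. Hence q ↦ -q removes every sign from the terms (-1)ⁿ q^(n²).
sign-square : ∀ n → sign (n ℕ.* n) ≡ sign n
sign-square zero    = refl
sign-square (suc n) = cong -_ (begin
  sign (n ℕ.+ n ℕ.* suc n)                  ≡⟨ cong (λ k → sign (n ℕ.+ k)) (ℕₚ.*-suc n n) ⟩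
  sign (n ℕ.+ (n ℕ.+ n ℕ.* n))              ≡⟨ sign-+ n (n ℕ.+ n ℕ.* n) ⟩
  sign n * sign (n ℕ.+ n ℕ.* n)             ≡⟨ cong (sign n *_) (sign-+ n (n ℕ.* n)) ⟩
  sign n * (sign n * sign (n ℕ.* n))        ≡⟨ ℤₚ.*-assoc (sign n) (sign n) (sign (n ℕ.* n)) ⟨
  sign n * sign n * sign (n ℕ.* n)          ≡⟨ cong (_* sign (n ℕ.* n)) (sign² n) ⟩
  1ℤ * sign (n ℕ.* n)                       ≡⟨ ℤₚ.*-identityˡ (sign (n ℕ.* n)) ⟩
  sign (n ℕ.* n)                            ≡⟨ sign-square n ⟩
  sign n                                    ∎)
  where open ≡-Reasoning

const-·-const-· : ∀ c d a → const c · (const d · a) ≋ const (c * d) · a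
const-·-const-· c d a .at n = begin
  (const c · (const d · a)) n     ≡⟨ const-· c (const d · a) n ⟩
  c * (const d · a) n             ≡⟨ cong (c *_) (const-· d a n) ⟩
  c * (d * a n)                   ≡⟨ ℤₚ.*-assoc c d (a n) ⟨
  (c * d) * a n                   ≡⟨ const-· (c * d) a n ⟨
  (const (c * d) · a) n           ∎
  where open ≡-Reasoning

merge-⊕ : ∀ e o e′ o′ n → merge (e ⊕ e′) (o ⊕ o′) n ≡ merge e o n + merge e′ o′ n
merge-⊕ e o e′ o′ zero    = refl
merge-⊕ e o e′ o′ (suc n) = merge-⊕ o (tl e) o′ (tl e′) n

E2-⊕ : ∀ a b → E2 (a ⊕ b) ≋ E2 a ⊕ E2 b
E2-⊕ a b .at n = trans
  (merge-local n (λ _ _ → refl) (λ { zero _ → refl ; (suc _) _ → refl }))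
  (merge-⊕ a (const 0ℤ) b (const 0ℤ) n)

σ-⊕ : ∀ a b → σ (a ⊕ b) ≋ σ a ⊕ σ b
σ-⊕ a b .at n = trans
  (merge-local n (λ _ _ → refl) (λ i _ → ℤₚ.neg-distrib-+ (od a i) (od b i)))
  (merge-⊕ (ev a) (neg (od a)) (ev b) (neg (od b)) n)

σ-E2 : ∀ a → σ (E2 a) ≋ E2 a
σ-E2 a .at n = merge-local n (λ i _ → at (ev-E2 a) i)
  (λ i _ → trans (cong -_ (trans (at (od-E2 a) i) (const-0 i))) (sym (const-0 i)))

σ-const· : ∀ c a → σ (const c · a) ≋ const c · σ a
σ-const· c a = ≋-trans (σ-· (const c) a)
  (·-congʳ (≋-trans (σ-cong (≋-sym (E2-const c))) (≋-trans (σ-E2 (const c)) (E2-const c))))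

σ-one : σ one ≋ one
σ-one = ≋-trans (σ-cong (≋-sym E2-one)) (≋-trans (σ-E2 one) E2-one)

σ-X^ : ∀ d → σ (X^ d) ≋ const (sign d) · X^ d
σ-X^ zero    = ≋-trans σ-one (solve 0 (:1 := con 1ℤ :* :1) ≋-refl)
σ-X^ (suc d) = begin
  σ (X^ (suc d))                          ≈⟨ σ-cong (X^-suc d) ⟩
  σ (q · X^ d)                            ≈⟨ σ-· q (X^ d) ⟩
  σ q · σ (X^ d)                          ≈⟨ ·-cong σ-q (σ-X^ d) ⟩
  neg q · (const (sign d) · X^ d)
    ≈⟨ solve 3 (λ q s x → (:- q) :* (s :* x) := (:- s) :* (q :* x)) ≋-refl q (const (sign d)) (X^ d) ⟩
  neg (const (sign d)) · (q · X^ d)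
    ≈⟨ ·-cong (-‿homo (sign d)) (X^-suc d) ⟨
  const (- sign d) · X^ (suc d)           ∎
  where
  open ≋-Reasoning
  open _-Raw-AlmostCommutative⟶_ const-homomorphism using (-‿homo)
  σ-q : σ q ≋ neg q
  σ-q = ev-od-injective
    (≋-trans (ev-σ q) (≋-trans ev-q (≋-trans (solve 0 (con 0ℤ
         := :- con 0ℤ) ≋-refl) (neg-cong (≋-sym ev-q)))))
    (od-σ q)

-- Odd squares drop out. The term of index 2s has sign +1 and exponent 4s², which `ev` halves to
-- 2s²; what remains is φ evaluated at q².
ev-Θ-partial : ∀ n → ev (Θ-partial (double n)) ≋ E2 (σ (Θ-partial n))
ev-Θ-partial zero    = ≋-trans (ev-X^double 0) (≋-trans (≋-sym E2-one) (E2-cong (≋-sym σ-one)))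
ev-Θ-partial (suc n) = begin
  ev (Θ-partial (double n)) ⊕ ev (const c₁ · X^ (1+2n ℕ.* 1+2n)) ⊕ ev (const c₂ · X^ (double s ℕ.* double s))
    ≈⟨ ⊕-cong (⊕-cong (ev-Θ-partial n) odd-term) even-term ⟩
  E2 (σ (Θ-partial n)) ⊕ const 0ℤ ⊕ E2 (σ (const c · X^ (s ℕ.* s)))
    ≈⟨ solve 2 (λ a b → a :+ con 0ℤ :+ b
         := a :+ b) ≋-refl (E2 (σ (Θ-partial n))) (E2 (σ (const c · X^ (s ℕ.* s)))) ⟩
  E2 (σ (Θ-partial n)) ⊕ E2 (σ (const c · X^ (s ℕ.* s)))
    ≈⟨ E2-⊕ (σ (Θ-partial n)) (σ (const c · X^ (s ℕ.* s))) ⟨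
  E2 (σ (Θ-partial n) ⊕ σ (const c · X^ (s ℕ.* s)))
    ≈⟨ E2-cong (σ-⊕ (Θ-partial n) (const c · X^ (s ℕ.* s))) ⟨
  E2 (σ (Θ-partial (suc n))) ∎
  where
  open ≋-Reasoning
  s 1+2n : ℕ
  s = suc n
  1+2n = suc (double n)
  c c₁ c₂ : ℤ
  c = + 2 * sign s
  c₁ = + 2 * sign 1+2n
  c₂ = + 2 * sign (double s)
  odd-term : ev (const c₁ · X^ (1+2n ℕ.* 1+2n)) ≋ const 0ℤ
  odd-term = begin
    ev (const c₁ · X^ (1+2n ℕ.* 1+2n))   ≈⟨ ev-const· c₁ (X^ (1+2n ℕ.* 1+2n)) ⟩
    const c₁ · ev (X^ (1+2n ℕ.* 1+2n))   ≡⟨ cong (λ d → const c₁ · ev (X^ d)) ([1+double]² n) ⟩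
    const c₁ · ev (X^ (suc (double (n ℕ.+ n ℕ.* 1+2n))))
      ≈⟨ ·-congˡ (ev-X^suc-double (n ℕ.+ n ℕ.* 1+2n)) ⟩
    const c₁ · const 0ℤ                  ≈⟨ solve 1 (λ x → x :* con 0ℤ := con 0ℤ) ≋-refl (const c₁) ⟩
    const 0ℤ                             ∎
  σ-term : σ (const c · X^ (s ℕ.* s)) ≋ const (+ 2) · X^ (s ℕ.* s)
  σ-term = begin
    σ (const c · X^ (s ℕ.* s))                           ≈⟨ σ-const· c (X^ (s ℕ.* s)) ⟩
    const c · σ (X^ (s ℕ.* s))                           ≈⟨ ·-congˡ (σ-X^ (s ℕ.* s)) ⟩
    const c · (const (sign (s ℕ.* s)) · X^ (s ℕ.* s))
      ≈⟨ const-·-const-· c (sign (s ℕ.* s)) (X^ (s ℕ.* s)) ⟩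
    const (c * sign (s ℕ.* s)) · X^ (s ℕ.* s)            ≡⟨ cong (λ z → const z · X^ (s ℕ.* s)) c*sign ⟩
    const (+ 2) · X^ (s ℕ.* s)                           ∎
    where
    c*sign : c * sign (s ℕ.* s) ≡ + 2
    c*sign = trans (cong (c *_) (sign-square s))
      (trans (ℤₚ.*-assoc (+ 2) (sign s) (sign s)) (cong (+ 2 *_) (sign² s)))
  even-term : ev (const c₂ · X^ (double s ℕ.* double s)) ≋ E2 (σ (const c · X^ (s ℕ.* s)))
  even-term = begin
    ev (const c₂ · X^ (double s ℕ.* double s))          ≈⟨ ev-const· c₂ (X^ (double s ℕ.* double s)) ⟩
    const c₂ · ev (X^ (double s ℕ.* double s))
      ≡⟨ cong₂ (λ z d → const (+ 2 * z) · ev (X^ d)) (sign-double s) (double² s) ⟩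
    const (+ 2) · ev (X^ (double (double (s ℕ.* s))))   ≈⟨ ·-congˡ (ev-X^double (double (s ℕ.* s))) ⟩
    const (+ 2) · X^ (double (s ℕ.* s))                 ≈⟨ ·-congˡ (X^double≋E2 (s ℕ.* s)) ⟩
    const (+ 2) · E2 (X^ (s ℕ.* s))                     ≈⟨ E2-const· (+ 2) (X^ (s ℕ.* s)) ⟨
    E2 (const (+ 2) · X^ (s ℕ.* s))                     ≈⟨ E2-cong σ-term ⟨
    E2 (σ (const c · X^ (s ℕ.* s)))                     ∎

ev-Θ : ev Θ ≋ E2 (σ Θ)
ev-Θ .at m = begin
  Θ (double m)                      ≡⟨ Θ-partial-stable (double N) (double m) (double-mono-≤ m≤N) ⟨
  ev (Θ-partial (double N)) m       ≡⟨ at (ev-Θ-partial N) m ⟩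
  E2 (σ (Θ-partial N)) m            ≡⟨ merge-local m σ≡ (λ _ _ → refl) ⟩
  E2 (σ Θ) m                        ∎
  where
  open ≡-Reasoning
  N : ℕ
  -- Large enough for the odd coefficients up to 2m + 1 read by `σ`.
  N = suc (double m)
  m≤N : m ≤ N
  m≤N = ℕₚ.m≤n⇒m≤1+n (n≤double m)
  σ≡ : ∀ i → i ≤ m → σ (Θ-partial N) i ≡ σ Θ i
  σ≡ i i≤m = merge-local i
    (λ j j≤i → Θ-partial-stable N (double j) (ℕₚ.m≤n⇒m≤1+n (double-mono-≤ (ℕₚ.≤-trans j≤i i≤m))))
    (λ j j≤i → cong -_ (Θ-partial-stable N (suc (double j)) (s≤s (double-mono-≤ (ℕₚ.≤-trans j≤i i≤m)))))

-- Uniqueness for equations involving q ↦ q²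

opaque
  unfolding _·_

  ·-at-0 : ∀ a b → (a · b) 0 ≡ a 0 * b 0
  ·-at-0 a b = ℤₚ.+-identityʳ (a 0 * b 0)

  ·-at-suc : ∀ a b n → (a · b) (suc n) ≡ a 0 * b (suc n) + (tl a · b) n
  ·-at-suc a b n = refl

q·-cancel : ∀ {a b} → q · a ≋ q · b → a ≋ b
q·-cancel {a} {b} qa≋qb .at n = trans (sym (q·-suc a n)) (trans (at qa≋qb (suc n)) (q·-suc b n))

·-vanish : ∀ a b n → (∀ i → i ≤ n → b i ≡ 0ℤ) → (a · b) n ≡ 0ℤ
·-vanish a b n b≡0 = begin
  (a · b) n          ≡⟨ ·-local n (λ _ _ → refl) (λ i i≤n → trans (b≡0 i i≤n) (sym (const-0 i))) ⟩
  (a · const 0ℤ) n   ≡⟨ at (solve 1 (λ a → a :* con 0ℤ := con 0ℤ) ≋-refl a) n ⟩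
  const 0ℤ n         ≡⟨ const-0 n ⟩
  0ℤ                 ∎
  where open ≡-Reasoning

-- At an even index i the coefficient of `E2 a` is that of `a` at i/2, and half of n + 1, rounded
-- down, is at most n. The gain of one vanishing coefficient drives `descent`.
E2-vanish : ∀ a n → (∀ i → i ≤ n → a i ≡ 0ℤ) → ∀ i → i ≤ suc n → E2 a i ≡ 0ℤ
E2-vanish a n       a≡0 zero          _               = a≡0 0 z≤n
E2-vanish a n       a≡0 (suc zero)    _               = refl
E2-vanish a (suc n) a≡0 (suc (suc i)) (s≤s (s≤s i≤n)) = begin
  merge (tl a) (tl (const 0ℤ)) i
    ≡⟨ merge-local i (λ j j≤i → trans (a≡0 (suc j) (s≤s (ℕₚ.≤-trans j≤i i≤n))) (sym (const-0 j)))
                     (λ j _ → sym (const-0 j)) ⟩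
  E2 (const 0ℤ) i          ≡⟨ at (E2-const 0ℤ) i ⟩
  const 0ℤ i               ≡⟨ const-0 i ⟩
  0ℤ                       ∎
  where open ≡-Reasoning

-- The right-hand side sees only the first half of the coefficients of d.
descent : ∀ u c d → u 0 ≢ 0ℤ → d 0 ≡ 0ℤ → u · d ≋ c · E2 d → d ≋ const 0ℤ
descent u c d u₀≢0 d₀≡0 ud≋cE2d .at n = trans (vanish n n ℕₚ.≤-refl) (sym (const-0 n))
  where
  vanish : ∀ n i → i ≤ n → d i ≡ 0ℤ
  vanish zero    zero z≤n = d₀≡0
  vanish (suc n) i i≤1+n with i ℕ.≟ suc n
  ... | no i≢1+n = vanish n i (ℕₚ.≤-pred (ℕₚ.≤∧≢⇒< i≤1+n i≢1+n))
  ... | yes refl with ℤₚ.i*j≡0⇒i≡0∨j≡0 (u 0) u₀dₙ≡0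
    where
    open ≡-Reasoning
    u₀dₙ≡0 : u 0 * d (suc n) ≡ 0ℤ
    u₀dₙ≡0 = begin
      u 0 * d (suc n)                         ≡⟨ ℤₚ.+-identityʳ (u 0 * d (suc n)) ⟨
      u 0 * d (suc n) + 0ℤ
        ≡⟨ +-congˡ (u 0 * d (suc n)) (·-vanish (tl u) d n (vanish n)) ⟨
      u 0 * d (suc n) + (tl u · d) n          ≡⟨ ·-at-suc u d n ⟨
      (u · d) (suc n)                         ≡⟨ at ud≋cE2d (suc n) ⟩
      (c · E2 d) (suc n)                      ≡⟨ ·-vanish c (E2 d) (suc n) (E2-vanish d n (vanish n)) ⟩
      0ℤ                                      ∎
  ...   | inj₁ u₀≡0 = contradiction u₀≡0 u₀≢0
  ...   | inj₂ dₙ≡0 = dₙ≡0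

⊝≋0⇒≋ : ∀ {a b} → a ⊝ b ≋ const 0ℤ → a ≋ b
⊝≋0⇒≋ {a} {b} a-b≋0 = begin
  a              ≈⟨ solve 2 (λ a b → a := (a :- b) :+ b) ≋-refl a b ⟩
  (a ⊝ b) ⊕ b    ≈⟨ ⊕-cong a-b≋0 (≋-refl {b}) ⟩
  const 0ℤ ⊕ b   ≈⟨ solve 1 (λ b → con 0ℤ :+ b := b) ≋-refl b ⟩
  b              ∎
  where open ≋-Reasoning

-- Factoring u² - v² makes the equation for the difference u - v linear, with leading factor (u + v)
-- w, so that `descent` applies.
square-E2-unique : ∀ {c w u v} → ((u ⊕ v) · w) 0 ≢ 0ℤ → u 0 ≡ v 0 →
  u · u · w ≋ c · E2 u → v · v · w ≋ c · E2 v → u ≋ v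
square-E2-unique {c} {w} {u} {v} unit u₀≡v₀ u²g≋ v²g≋ =
  ⊝≋0⇒≋ (descent ((u ⊕ v) · w) c (u ⊝ v) unit (ℤₚ.i≡j⇒i-j≡0 u₀≡v₀) (begin
    (u ⊕ v) · w · (u ⊝ v)
      ≈⟨ solve 3 (λ w u v → (u :+ v) :* w :* (u :- v) := u :* u :* w :- v :* v :* w) ≋-refl w u v ⟩
    u · u · w ⊝ v · v · w            ≈⟨ ⊕-cong u²g≋ (neg-cong v²g≋) ⟩
    c · E2 u ⊝ c · E2 v
      ≈⟨ solve 3 (λ c x y → c :* x :- c :* y := c :* (x :- y)) ≋-refl c (E2 u) (E2 v) ⟩
    c · (E2 u ⊝ E2 v)                ≈⟨ ·-congˡ (E2-⊝ u v) ⟨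
    c · E2 (u ⊝ v)                   ∎))
  where open ≋-Reasoning

-- Quadratic and quartic theta identities

f₁ f₂ φ Θ² : PowerSeries
f₁ = f 1
f₂ = E2 (f 1)
φ = σ Θ
Θ² = Θ · Θ

f₁²≋f₂·Θ : f₁ · f₁ ≋ f₂ · Θ
f₁²≋f₂·Θ = ≋-trans f₁²≋f₂Θ (·-congʳ f₂≋E2f₁)

norm-f₁·f₂ : norm f₁ · f₂ ≋ f₁ · f₁ · f₁
norm-f₁·f₂ = ≋-trans (·-congˡ (≋-sym f₂≋E2f₁)) norm-f₁

-- Taking norms in Θ = f₁² / f₂ gives (f₁³ / f₂)² / f₁² = f₁⁴ / f₂², which is Θ² again. Cancelling
-- f₁² f₂² takes the place of the divisions. Classically this is φ(q) φ(-q) = φ(-q²)².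
norm-Θ : norm Θ ≋ Θ²
norm-Θ = cancel (begin
  f₁ · f₁ · (f₂ · f₂) · norm Θ
    ≈⟨ solve 3 (λ f₁ f₂ N → f₁ :* f₁ :* (f₂ :* f₂) :* N
         := f₂ :* f₂ :* ((f₁ :* f₁) :* N)) ≋-refl f₁ f₂ (norm Θ) ⟩
  f₂ · f₂ · (f₁ · f₁ · norm Θ)               ≈⟨ ·-congˡ (·-congʳ (norm-E2 f₁)) ⟨
  f₂ · f₂ · (norm f₂ · norm Θ)              ≈⟨ ·-congˡ (norm-· f₂ Θ) ⟨
  f₂ · f₂ · norm (f₂ · Θ)                   ≈⟨ ·-congˡ (norm-cong f₁²≋f₂·Θ) ⟨
  f₂ · f₂ · norm (f₁ · f₁)                   ≈⟨ ·-congˡ (norm-· f₁ f₁) ⟩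
  f₂ · f₂ · (norm f₁ · norm f₁)
    ≈⟨ solve 2 (λ f₂ n → f₂ :* f₂ :* (n :* n) := (n :* f₂) :* (n :* f₂)) ≋-refl f₂ (norm f₁) ⟩
  (norm f₁ · f₂) · (norm f₁ · f₂)            ≈⟨ ·-cong norm-f₁·f₂ norm-f₁·f₂ ⟩
  (f₁ · f₁ · f₁) · (f₁ · f₁ · f₁)
    ≈⟨ solve 1 (λ f₁ → (f₁ :* f₁ :* f₁) :* (f₁ :* f₁ :* f₁)
         := f₁ :* f₁ :* ((f₁ :* f₁) :* (f₁ :* f₁))) ≋-refl f₁ ⟩
  f₁ · f₁ · ((f₁ · f₁) · (f₁ · f₁))            ≈⟨ ·-congˡ (·-cong f₁²≋f₂·Θ f₁²≋f₂·Θ) ⟩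
  f₁ · f₁ · ((f₂ · Θ) · (f₂ · Θ))
    ≈⟨ solve 3 (λ f₁ f₂ t → f₁ :* f₁ :* ((f₂ :* t) :* (f₂ :* t))
         := f₁ :* f₁ :* (f₂ :* f₂) :* (t :* t)) ≋-refl f₁ f₂ Θ ⟩
  f₁ · f₁ · (f₂ · f₂) · Θ²                    ∎)
  where
  open ≋-Reasoning
  cancel : ∀ {b c} → f₁ · f₁ · (f₂ · f₂) · b ≋ f₁ · f₁ · (f₂ · f₂) · c → b ≋ c
  cancel = ·-cancelˡ (f₁ · f₁ · (f₂ · f₂)) (trans (·-at-0 (f₁ · f₁) (f₂ · f₂)) (cong₂ _*_ (·-at-0 f₁ f₁) (·-at-0 f₂ f₂)))

-- φ(q)² + φ(-q)² = 2 φ(q²)²: with d = ev Θ² - φ², norm-Θ and ev Θ = φ(q²) give d = -2 d(q²).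
ev-Θ² : ev Θ² ≋ φ · φ
ev-Θ² = ⊝≋0⇒≋ (descent one (const (- + 2)) (ev Θ² ⊝ φ · φ) (λ ())
  (cong₂ _-_ (·-at-0 Θ Θ) (·-at-0 φ φ))
  (begin
    one · (ev Θ² ⊝ φ · φ)
      ≈⟨ ·-congˡ (⊕-cong (ev-· Θ Θ) (≋-refl {neg (φ · φ)})) ⟩
    one · (e · e ⊕ q · (o · o) ⊝ φ · φ)
      -- e² + q o² is rewritten as 2 e² minus the norm, since closed forms are available for e² and
      -- for the norm.
      ≈⟨ solve 4 (λ q e o p → :1 :* (e :* e :+ q :* (o :* o) :- p)
           := con (+ 2) :* (e :* e) :- ((e :* e :- q :* (o :* o)) :+ p)) ≋-refl q e o (φ · φ) ⟩
    const (+ 2) · (e · e) ⊝ (norm Θ ⊕ φ · φ)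
      ≈⟨ ⊕-cong (·-congˡ e²) (neg-cong (⊕-cong norm-Θ (≋-sym (σ-· Θ Θ)))) ⟩
    const (+ 2) · E2 (φ · φ) ⊝ (Θ² ⊕ σ Θ²)
      ≈⟨ ⊕-cong (≋-refl {const (+ 2) · E2 (φ · φ)}) (neg-cong (⊕-σ Θ²)) ⟩
    const (+ 2) · E2 (φ · φ) ⊝ const (+ 2) · E2 (ev Θ²)
      ≈⟨ solve 2 (λ x y → con (+ 2) :* x :- con (+ 2) :* y
           := con (- + 2) :* (y :- x)) ≋-refl (E2 (φ · φ)) (E2 (ev Θ²)) ⟩
    const (- + 2) · (E2 (ev Θ²) ⊝ E2 (φ · φ))
      ≈⟨ ·-congˡ (E2-⊝ (ev Θ²) (φ · φ)) ⟨
    const (- + 2) · E2 (ev Θ² ⊝ φ · φ) ∎))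
  where
  open ≋-Reasoning
  e o : PowerSeries
  e = ev Θ
  o = od Θ
  e² : e · e ≋ E2 (φ · φ)
  e² = ≋-trans (·-cong ev-Θ ev-Θ) (≋-sym (E2-· φ φ))

od-Θ⁴ : od (Θ² · Θ²) ≋ const (+ 2) · (φ · φ · od Θ²)
od-Θ⁴ = begin
  od (Θ² · Θ²)                               ≈⟨ od-· Θ² Θ² ⟩
  ev Θ² · od Θ² ⊕ od Θ² · ev Θ²
    ≈⟨ solve 2 (λ e o → e :* o :+ o :* e := con (+ 2) :* (e :* o)) ≋-refl (ev Θ²) (od Θ²) ⟩
  const (+ 2) · (ev Θ² · od Θ²)              ≈⟨ ·-congˡ (·-congʳ ev-Θ²) ⟩
  const (+ 2) · (φ · φ · od Θ²)             ∎
  where open ≋-Reasoning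

-- q (od Θ²)² = φ(q)⁴ - φ(-q)⁴, computed once from the norm of Θ² and once from the odd part of Θ⁴.
od-Θ²-square : od Θ² · od Θ² ≋ const (- + 2) · E2 (od (Θ² · Θ²))
od-Θ²-square = q·-cancel (begin
  q · (h · h)
    ≈⟨ solve 3 (λ q h e → q :* (h :* h) := e :* e :- (e :* e :- q :* (h :* h))) ≋-refl q h (ev Θ²) ⟩
  ev Θ² · ev Θ² ⊝ norm Θ²
    ≈⟨ ⊕-cong (·-cong ev-Θ² ev-Θ²) (neg-cong (≋-trans (norm-· Θ Θ) (·-cong norm-Θ norm-Θ))) ⟩
  (φ · φ) · (φ · φ) ⊝ Θ² · Θ²
    ≈⟨ ⊕-cong (≋-trans (σ-· Θ² Θ²) (·-cong (σ-· Θ Θ) (σ-· Θ Θ))) (≋-refl {neg (Θ² · Θ²)}) ⟨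
  σ (Θ² · Θ²) ⊝ Θ² · Θ²
    ≈⟨ solve 2 (λ s t → s :- t := :- (t :- s)) ≋-refl (σ (Θ² · Θ²)) (Θ² · Θ²) ⟩
  neg (Θ² · Θ² ⊝ σ (Θ² · Θ²))                       ≈⟨ neg-cong (⊝-σ (Θ² · Θ²)) ⟩
  neg (const (+ 2) · (q · E2 (od (Θ² · Θ²))))
    ≈⟨ solve 2 (λ q x → :- (con (+ 2) :* (q :* x))
         := q :* (con (- + 2) :* x)) ≋-refl q (E2 (od (Θ² · Θ²))) ⟩
  q · (const (- + 2) · E2 (od (Θ² · Θ²)))         ∎)
  where
  open ≋-Reasoning
  h : PowerSeries
  h = od Θ²

-- The product formula φ(q) = f₂⁵ / (f₁² f₄²): Gauss's formula at -q gives f₂ φ = f₁(-q)², and the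
-- norm of f₁ gives f₁(-q) = f₂³ / (f₁ f₄).
φ-product : φ · (f₁ · f₁) · (E2 f₂ · E2 f₂) ≋ f₂ · f₂ · f₂ · f₂ · f₂
φ-product = ·-cancelˡ f₂ refl (begin
  f₂ · (φ · (f₁ · f₁) · (f₄ · f₄))
    ≈⟨ solve 4 (λ f₂ p f₁ G → f₂ :* (p :* (f₁ :* f₁) :* (G :* G))
         := (f₂ :* p) :* (f₁ :* f₁) :* (G :* G)) ≋-refl f₂ φ f₁ f₄ ⟩
  (f₂ · φ) · (f₁ · f₁) · (f₄ · f₄)              ≈⟨ ·-congʳ (·-congʳ f₂φ) ⟩
  (σ f₁ · σ f₁) · (f₁ · f₁) · (f₄ · f₄)
    ≈⟨ solve 3 (λ s f₁ G → (s :* s) :* (f₁ :* f₁) :* (G :* G)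
         := ((f₁ :* s) :* G) :* ((f₁ :* s) :* G)) ≋-refl (σ f₁) f₁ f₄ ⟩
  ((f₁ · σ f₁) · f₄) · ((f₁ · σ f₁) · f₄)        ≈⟨ ·-cong f₁σf₁f₄ f₁σf₁f₄ ⟩
  (f₂ · f₂ · f₂) · (f₂ · f₂ · f₂)
    ≈⟨ solve 1 (λ f₂ → (f₂ :* f₂ :* f₂) :* (f₂ :* f₂ :* f₂)
         := f₂ :* (f₂ :* f₂ :* f₂ :* f₂ :* f₂)) ≋-refl f₂ ⟩
  f₂ · (f₂ · f₂ · f₂ · f₂ · f₂)                    ∎)
  where
  open ≋-Reasoning
  f₄ : PowerSeries
  f₄ = E2 f₂
  f₂φ : f₂ · φ ≋ σ f₁ · σ f₁
  f₂φ = begin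
    f₂ · φ            ≈⟨ ·-congʳ (σ-E2 f₁) ⟨
    σ f₂ · σ Θ        ≈⟨ σ-· f₂ Θ ⟨
    σ (f₂ · Θ)        ≈⟨ σ-cong f₁²≋f₂·Θ ⟨
    σ (f₁ · f₁)        ≈⟨ σ-· f₁ f₁ ⟩
    σ f₁ · σ f₁        ∎
  f₁σf₁f₄ : (f₁ · σ f₁) · f₄ ≋ f₂ · f₂ · f₂
  f₁σf₁f₄ = begin
    (f₁ · σ f₁) · E2 f₂          ≈⟨ ·-congʳ (·-σ f₁) ⟩
    E2 (norm f₁) · E2 f₂        ≈⟨ E2-· (norm f₁) f₂ ⟨
    E2 (norm f₁ · f₂)           ≈⟨ E2-cong norm-f₁·f₂ ⟩
    E2 (f₁ · f₁ · f₁)            ≈⟨ E2-· (f₁ · f₁) f₁ ⟩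
    E2 (f₁ · f₁) · f₂            ≈⟨ ·-congʳ (E2-· f₁ f₁) ⟩
    f₂ · f₂ · f₂                 ∎

-- The odd part of f₁⁸

pow-+ : ∀ a m n → a ↑ (m ℕ.+ n) ≋ a ↑ m · a ↑ n
pow-+ a zero    n = ≋-trans (≋-sym (·-identityˡ (a ↑ n))) (·-congʳ (≋-sym (pow-zero a)))
pow-+ a (suc m) n = begin
  a ↑ (suc (m ℕ.+ n))          ≈⟨ pow-suc a (m ℕ.+ n) ⟩
  a · a ↑ (m ℕ.+ n)            ≈⟨ ·-congˡ (pow-+ a m n) ⟩
  a · (a ↑ m · a ↑ n)        ≈⟨ ·-assoc a (a ↑ m) (a ↑ n) ⟨
  a · a ↑ m · a ↑ n          ≈⟨ ·-congʳ (pow-suc a m) ⟨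
  a ↑ (suc m) · a ↑ n        ∎
  where open ≋-Reasoning

pow-4 : ∀ a → a ↑ 4 ≋ (a · a) · (a · a)
pow-4 a = ≋-trans (pow-+ a 2 2) (·-cong pow-2 pow-2)
  where
  pow-2 : a ↑ 2 ≋ a · a
  pow-2 = ≋-trans (pow-suc a 1) (·-congˡ (≋-trans (pow-suc a 0) (≋-trans (·-congˡ (pow-zero a)) (·-identityʳ a))))

pow-8 : ∀ a → a ↑ 8 ≋ a ↑ 4 · a ↑ 4
pow-8 a = pow-+ a 4 4

f₁⁸≋f₂⁴Θ⁴ : f₁ ↑ 8 ≋ E2 (f₁ ↑ 4) · (Θ² · Θ²)
f₁⁸≋f₂⁴Θ⁴ = begin
  f₁ ↑ 8                                    ≈⟨ ≋-trans (pow-8 f₁) (·-cong (pow-4 f₁) (pow-4 f₁)) ⟩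
  (f₁ · f₁) · (f₁ · f₁) · ((f₁ · f₁) · (f₁ · f₁))
    ≈⟨ ·-cong (·-cong f₁²≋f₂·Θ f₁²≋f₂·Θ) (·-cong f₁²≋f₂·Θ f₁²≋f₂·Θ) ⟩
  (f₂ · Θ) · (f₂ · Θ) · ((f₂ · Θ) · (f₂ · Θ))
    ≈⟨ solve 2 (λ f₂ t → (f₂ :* t) :* (f₂ :* t) :* ((f₂ :* t) :* (f₂ :* t))
         := (f₂ :* f₂) :* (f₂ :* f₂) :* ((t :* t) :* (t :* t))) ≋-refl f₂ Θ ⟩
  (f₂ · f₂) · (f₂ · f₂) · (Θ² · Θ²)                ≈⟨ ·-congʳ (≋-trans (E2-pow f₁ 4) (pow-4 f₂)) ⟨
  E2 (f₁ ↑ 4) · (Θ² · Θ²)                     ∎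
  where open ≋-Reasoning

od-f₁⁸≋f₁⁴·od-Θ⁴ : od (f₁ ↑ 8) ≋ f₁ ↑ 4 · od (Θ² · Θ²)
od-f₁⁸≋f₁⁴·od-Θ⁴ = ≋-trans (od-cong f₁⁸≋f₂⁴Θ⁴) (od-E2· (f₁ ↑ 4) (Θ² · Θ²))

φ⁴ : PowerSeries
φ⁴ = (φ · φ) · (φ · φ)

-- With u = od f₁⁸ and h = od Θ², u = f₁⁴ od Θ⁴ = 2 f₁⁴ φ² h, so u² = 4 f₁⁸ φ⁴ h². By
-- `od-Θ²-square`, h² is -2 times od Θ⁴ at q², and the factor f₂⁴ completes that series to u at q².
od-f₁⁸-square : od (f₁ ↑ 8) · od (f₁ ↑ 8) · E2 (f₁ ↑ 4)
  ≋ const (- + 8) · (f₁ ↑ 8 · φ⁴) · E2 (od (f₁ ↑ 8))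
od-f₁⁸-square = begin
  od (f₁ ↑ 8) · od (f₁ ↑ 8) · E2 f₁⁴
    ≈⟨ ·-congʳ (·-cong od-f₁⁸≋2f₁⁴φ²h od-f₁⁸≋2f₁⁴φ²h) ⟩
  (f₁⁴ · (const (+ 2) · (φ · φ · h))) · (f₁⁴ · (const (+ 2) · (φ · φ · h))) · E2 f₁⁴
    ≈⟨ solve 4 (λ f₁⁴ p h f₂⁴ → (f₁⁴ :* (con (+ 2) :* (p :* p :* h))) :* (f₁⁴ :* (con (+ 2) :* (p :* p :* h))) :* f₂⁴
         := con (+ 4) :* (f₁⁴ :* f₁⁴ :* ((p :* p) :* (p :* p))) :* f₂⁴ :* (h :* h))
              ≋-refl f₁⁴ φ h (E2 f₁⁴) ⟩
  const (+ 4) · (f₁⁴ · f₁⁴ · φ⁴) · E2 f₁⁴ · (h · h)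
    ≈⟨ ·-cong (·-congʳ (·-congˡ (·-congʳ (≋-sym (pow-8 f₁))))) od-Θ²-square ⟩
  const (+ 4) · (f₁ ↑ 8 · φ⁴) · E2 f₁⁴ · (const (- + 2) · E2 (od (Θ² · Θ²)))
    ≈⟨ solve 3 (λ x f₂⁴ y → con (+ 4) :* x :* f₂⁴ :* (con (- + 2) :* y)
         := con (- + 8) :* x :* (f₂⁴ :* y))
         ≋-refl (f₁ ↑ 8 · φ⁴) (E2 f₁⁴) (E2 (od (Θ² · Θ²))) ⟩
  const (- + 8) · (f₁ ↑ 8 · φ⁴) · (E2 f₁⁴ · E2 (od (Θ² · Θ²)))
    ≈⟨ ·-congˡ (≋-trans (E2-cong od-f₁⁸≋f₁⁴·od-Θ⁴) (E2-· f₁⁴ (od (Θ² · Θ²)))) ⟨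
  const (- + 8) · (f₁ ↑ 8 · φ⁴) · E2 (od (f₁ ↑ 8)) ∎
  where
  open ≋-Reasoning
  f₁⁴ h : PowerSeries
  f₁⁴ = f₁ ↑ 4
  h = od Θ²
  od-f₁⁸≋2f₁⁴φ²h : od (f₁ ↑ 8) ≋ f₁⁴ · (const (+ 2) · (φ · φ · h))
  od-f₁⁸≋2f₁⁴φ²h = ≋-trans od-f₁⁸≋f₁⁴·od-Θ⁴ (·-congˡ od-Θ⁴)

-- The fourth power of `φ-product`. It reduces the right-hand side of the functional equation for -8
-- f₂⁸ to 64 f₂²⁰, the value of the left-hand side.
f₁⁸φ⁴f₄⁸ : f₁ ↑ 8 · φ⁴ · E2 (f₂ ↑ 8)
  ≋ (f₂ · f₂ · f₂ · f₂ · f₂) · (f₂ · f₂ · f₂ · f₂ · f₂) · ((f₂ · f₂ · f₂ · f₂ · f₂) · (f₂ · f₂ · f₂ · f₂ · f₂))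
f₁⁸φ⁴f₄⁸ = begin
  f₁ ↑ 8 · φ⁴ · E2 (f₂ ↑ 8)
    ≈⟨ ·-cong (·-congʳ (expand f₁)) (≋-trans (E2-pow f₂ 8) (expand (E2 f₂))) ⟩
  ((f₁ · f₁) · (f₁ · f₁) · ((f₁ · f₁) · (f₁ · f₁))) · φ⁴ · ((f₄ · f₄) · (f₄ · f₄) · ((f₄ · f₄) · (f₄ · f₄)))
    ≈⟨ solve 3 (λ x p y → (x :* x :* (x :* x)) :* ((p :* p) :* (p :* p)) :* (y :* y :* (y :* y))
         := (p :* x :* y) :* (p :* x :* y) :* ((p :* x :* y) :* (p :* x :* y)))
              ≋-refl (f₁ · f₁) φ (f₄ · f₄) ⟩
  (φ · (f₁ · f₁) · (f₄ · f₄)) · (φ · (f₁ · f₁) · (f₄ · f₄)) · ((φ · (f₁ · f₁) · (f₄ · f₄)) · (φ · (f₁ · f₁) · (f₄ · f₄)))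
    ≈⟨ ·-cong (·-cong φ-product φ-product) (·-cong φ-product φ-product) ⟩
  (f₂ · f₂ · f₂ · f₂ · f₂) · (f₂ · f₂ · f₂ · f₂ · f₂) · ((f₂ · f₂ · f₂ · f₂ · f₂) · (f₂ · f₂ · f₂ · f₂ · f₂)) ∎
  where
  open ≋-Reasoning
  f₄ : PowerSeries
  f₄ = E2 f₂
  expand : ∀ a → a ↑ 8 ≋ (a · a) · (a · a) · ((a · a) · (a · a))
  expand a = ≋-trans (pow-8 a) (·-cong (pow-4 a) (pow-4 a))

od-f₁⁸ : od (f₁ ↑ 8) ≋ const (- + 8) · f₂ ↑ 8
od-f₁⁸ = square-E2-unique {c = const (- + 8) · (f₁ ↑ 8 · φ⁴)} {w = E2 (f₁ ↑ 4)}
  -- The constant term of (u + v) w is (-8 - 8) · 1 = -16.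
  (subst (_≢ 0ℤ) (sym (trans (·-at-0 (od (f₁ ↑ 8) ⊕ v) (E2 (f₁ ↑ 4))) (cong₂ _*_ (cong₂ _+_ f₁⁸-at-1 v₀) (pow-at-0 f₁ 4 refl))))
    (λ ()))
  (trans f₁⁸-at-1 (sym v₀))
  od-f₁⁸-square
  (begin
    v · v · E2 (f₁ ↑ 4)
      ≈⟨ ·-cong (·-cong (·-congˡ (expand)) (·-congˡ (expand))) (≋-trans (E2-pow f₁ 4) (pow-4 f₂)) ⟩
    const (- + 8) · f₂⁸ · (const (- + 8) · f₂⁸) · ((f₂ · f₂) · (f₂ · f₂))
      ≈⟨ solve 1 (λ f₂ → con (- + 8) :* (f₂ :* f₂ :* (f₂ :* f₂) :* (f₂ :* f₂ :* (f₂ :* f₂))) :* (con (- + 8) :* (f₂ :* f₂ :* (f₂ :* f₂) :* (f₂ :* f₂ :* (f₂ :* f₂)))) :* ((f₂ :* f₂) :* (f₂ :* f₂))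
           := con (+ 64) :* ((f₂ :* f₂ :* f₂ :* f₂ :* f₂) :* (f₂ :* f₂ :* f₂ :* f₂ :* f₂) :* ((f₂ :* f₂ :* f₂ :* f₂ :* f₂) :* (f₂ :* f₂ :* f₂ :* f₂ :* f₂))))
                ≋-refl f₂ ⟩
    const (+ 64) · ((f₂ · f₂ · f₂ · f₂ · f₂) · (f₂ · f₂ · f₂ · f₂ · f₂) · ((f₂ · f₂ · f₂ · f₂ · f₂) · (f₂ · f₂ · f₂ · f₂ · f₂)))
      ≈⟨ ·-congˡ f₁⁸φ⁴f₄⁸ ⟨
    const (+ 64) · (f₁ ↑ 8 · φ⁴ · E2 (f₂ ↑ 8))
      ≈⟨ solve 2 (λ x y → con (+ 64) :* (x :* y)
           := con (- + 8) :* x :* (con (- + 8) :* y)) ≋-refl (f₁ ↑ 8 · φ⁴) (E2 (f₂ ↑ 8)) ⟩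
    const (- + 8) · (f₁ ↑ 8 · φ⁴) · (const (- + 8) · E2 (f₂ ↑ 8))
      ≈⟨ ·-congˡ (E2-const· (- + 8) (f₂ ↑ 8)) ⟨
    const (- + 8) · (f₁ ↑ 8 · φ⁴) · E2 v ∎)
  where
  open ≋-Reasoning
  v f₂⁸ : PowerSeries
  v = const (- + 8) · f₂ ↑ 8
  f₂⁸ = f₂ · f₂ · (f₂ · f₂) · (f₂ · f₂ · (f₂ · f₂))
  v₀ : v 0 ≡ - + 8
  v₀ = trans (·-at-0 (const (- + 8)) (f₂ ↑ 8)) (cong (- + 8 *_) (pow-at-0 f₂ 8 refl))
  expand : f₂ ↑ 8 ≋ f₂⁸
  expand = ≋-trans (pow-8 f₂) (·-cong (pow-4 f₂) (pow-4 f₂))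

-- Dissections of powers of f₁ and f₂

inv-pow : ∀ a n → a 0 ≡ 1ℤ → (inv a) ↑ n · a ↑ n ≋ one
inv-pow a n a₀≡1 = begin
  (inv a) ↑ n · a ↑ n     ≈⟨ pow-· (inv a) a n ⟨
  (inv a · a) ↑ n           ≈⟨ pow-cong n (≋-trans (·-comm (inv a) a) (·-inv a a₀≡1)) ⟩
  one ↑ n                   ≈⟨ pow-one n ⟩
  one                         ∎
  where open ≋-Reasoning

pow-16 : ∀ a → a ↑ 16 ≋ a ↑ 8 · a ↑ 8
pow-16 a = pow-+ a 8 8

pow-24 : ∀ a → a ↑ 24 ≋ a ↑ 8 · (a ↑ 8 · a ↑ 8)
pow-24 a = ≋-trans (pow-+ a 8 16) (·-congˡ (pow-16 a))

f₁⁸ f₂⁸ f₁⁻⁸ f₂⁻⁸ : PowerSeries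
f₁⁸ = (f 1) ↑ 8
f₂⁸ = (f 2) ↑ 8
f₁⁻⁸ = (inv (f 1)) ↑ 8
f₂⁻⁸ = (inv (f 2)) ↑ 8

E2-pow-f₁ : ∀ n → E2 ((f 1) ↑ n) ≋ (f 2) ↑ n
E2-pow-f₁ n = ≋-trans (E2-pow (f 1) n) (pow-cong n (≋-sym f₂≋E2f₁))

od-f₁⁸-f₂ : od f₁⁸ ≋ const (- + 8) · f₂⁸
od-f₁⁸-f₂ = ≋-trans od-f₁⁸ (·-congˡ (pow-cong 8 (≋-sym f₂≋E2f₁)))

ev-pow-f₂ : ∀ n → ev ((f 2) ↑ n) ≋ (f 1) ↑ n
ev-pow-f₂ n = ≋-trans (ev-cong (≋-sym (E2-pow-f₁ n))) (ev-E2 ((f 1) ↑ n))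

f₁⁻⁸·f₁⁸ : f₁⁻⁸ · f₁⁸ ≋ one
f₁⁻⁸·f₁⁸ = inv-pow (f 1) 8 refl

f₂⁻⁸·f₂⁸ : f₂⁻⁸ · f₂⁸ ≋ one
f₂⁻⁸·f₂⁸ = inv-pow (f 2) 8 refl

f₂⁻⁸≋E2f₁⁻⁸ : f₂⁻⁸ ≋ E2 f₁⁻⁸
f₂⁻⁸≋E2f₁⁻⁸ = ·-cancelˡ f₂⁸ (pow-at-0 (f 2) 8 refl) (begin
  f₂⁸ · f₂⁻⁸              ≈⟨ ·-comm f₂⁸ f₂⁻⁸ ⟩
  f₂⁻⁸ · f₂⁸              ≈⟨ f₂⁻⁸·f₂⁸ ⟩
  one                ≈⟨ E2-one ⟨
  E2 one             ≈⟨ E2-cong f₁⁻⁸·f₁⁸ ⟨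
  E2 (f₁⁻⁸ · f₁⁸)         ≈⟨ E2-· f₁⁻⁸ f₁⁸ ⟩
  E2 f₁⁻⁸ · E2 f₁⁸        ≈⟨ ·-comm (E2 f₁⁻⁸) (E2 f₁⁸) ⟩
  E2 f₁⁸ · E2 f₁⁻⁸        ≈⟨ ·-congʳ (E2-pow-f₁ 8) ⟩
  f₂⁸ · E2 f₁⁻⁸           ∎)
  where open ≋-Reasoning

-- The eighth power of `norm-f₁`, with the odd part -8 f₂⁸ inserted; 64 is (-8)². It trades the
-- square of `ev f₁⁸` for f₁²⁴ / f₂⁸.
norm-f₁⁸ : (ev f₁⁸ · ev f₁⁸ ⊝ const (+ 64) · (q · (f₂⁸ · f₂⁸))) · f₂⁸ ≋ f₁⁸ · (f₁⁸ · f₁⁸)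
norm-f₁⁸ = begin
  (ev f₁⁸ · ev f₁⁸ ⊝ const (+ 64) · (q · (f₂⁸ · f₂⁸))) · f₂⁸
    ≈⟨ solve 3 (λ q e b → (e :* e :- con (+ 64) :* (q :* (b :* b))) :* b
         := (e :* e :- q :* ((con (- + 8) :* b) :* (con (- + 8) :* b))) :* b) ≋-refl q (ev f₁⁸) f₂⁸ ⟩
  (ev f₁⁸ · ev f₁⁸ ⊝ q · ((const (- + 8) · f₂⁸) · (const (- + 8) · f₂⁸))) · f₂⁸
    ≈⟨ ·-congʳ (⊕-cong (≋-refl {ev f₁⁸ · ev f₁⁸}) (neg-cong (·-congˡ (·-cong od-f₁⁸-f₂ od-f₁⁸-f₂)))) ⟨
  norm f₁⁸ · f₂⁸                                      ≈⟨ ·-congʳ (norm-pow (f 1) 8) ⟩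
  (norm (f 1)) ↑ 8 · (f 2) ↑ 8                ≈⟨ pow-· (norm (f 1)) (f 2) 8 ⟨
  (norm (f 1) · f 2) ↑ 8                        ≈⟨ pow-cong 8 norm-f₁ ⟩
  (f 1 · f 1 · f 1) ↑ 8                         ≈⟨ pow-· (f 1 · f 1) (f 1) 8 ⟩
  (f 1 · f 1) ↑ 8 · f₁⁸                           ≈⟨ ·-congʳ (pow-· (f 1) (f 1) 8) ⟩
  f₁⁸ · f₁⁸ · f₁⁸                                       ≈⟨ ·-assoc f₁⁸ f₁⁸ f₁⁸ ⟩
  f₁⁸ · (f₁⁸ · f₁⁸)                                     ∎
  where open ≋-Reasoning

ev-f₁¹⁶ : ev ((f 1) ↑ 16) ≋ const (+ 128) · (q · (f 2) ↑ 16) ⊕ (f 1) ↑ 24 · f₂⁻⁸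
ev-f₁¹⁶ = begin
  ev ((f 1) ↑ 16)                              ≈⟨ ev-cong (pow-16 (f 1)) ⟩
  ev (f₁⁸ · f₁⁸)                                     ≈⟨ ev-· f₁⁸ f₁⁸ ⟩
  e · e ⊕ q · (od f₁⁸ · od f₁⁸)
    ≈⟨ ⊕-cong (≋-refl {e · e}) (·-congˡ (·-cong od-f₁⁸-f₂ od-f₁⁸-f₂)) ⟩
  e · e ⊕ q · ((const (- + 8) · f₂⁸) · (const (- + 8) · f₂⁸))
    -- With b = f₂⁸, e² + 64 q b² = 128 q b² + (e² - 64 q b²). The bracket is the norm of f₁⁸; the
    -- trailing unit makes room for f₂⁻⁸ f₂⁸.
    ≈⟨ solve 3 (λ q e b → e :* e :+ q :* ((con (- + 8) :* b) :* (con (- + 8) :* b))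
         := con (+ 128) :* (q :* (b :* b)) :+ (e :* e :- con (+ 64) :* (q :* (b :* b))) :* :1)
              ≋-refl q e f₂⁸ ⟩
  const (+ 128) · (q · (f₂⁸ · f₂⁸)) ⊕ (e · e ⊝ const (+ 64) · (q · (f₂⁸ · f₂⁸))) · one
    ≈⟨ ⊕-cong (≋-refl {const (+ 128) · (q · (f₂⁸ · f₂⁸))}) (·-congˡ f₂⁻⁸·f₂⁸) ⟨
  const (+ 128) · (q · (f₂⁸ · f₂⁸)) ⊕ (e · e ⊝ const (+ 64) · (q · (f₂⁸ · f₂⁸))) · (f₂⁻⁸ · f₂⁸)
    ≈⟨ solve 4 (λ x n j b → x :+ n :* (j :* b) := x :+ n :* b :* j) ≋-refl
         (const (+ 128) · (q · (f₂⁸ · f₂⁸))) (e · e ⊝ const (+ 64) · (q · (f₂⁸ · f₂⁸))) f₂⁻⁸ f₂⁸ ⟩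
  const (+ 128) · (q · (f₂⁸ · f₂⁸)) ⊕ (e · e ⊝ const (+ 64) · (q · (f₂⁸ · f₂⁸))) · f₂⁸ · f₂⁻⁸
    ≈⟨ ⊕-cong (·-congˡ (·-congˡ (≋-sym (pow-16 (f 2))))) (·-congʳ (≋-trans norm-f₁⁸ (≋-sym (pow-24 (f 1))))) ⟩
  const (+ 128) · (q · (f 2) ↑ 16) ⊕ (f 1) ↑ 24 · f₂⁻⁸ ∎
  where
  open ≋-Reasoning
  e : PowerSeries
  e = ev f₁⁸

-- The Hecke relation τ(2n) = τ(2) τ(n) - 2^11 τ(n/2) for Ramanujan's τ, with τ(2) = -24, since q
-- f₁²⁴ generates τ.
od-f₁²⁴ : od ((f 1) ↑ 24) ≋ const (- + 24) · (f 1) ↑ 24 ⊕ const (- + 2048) · (q · (f 2) ↑ 24)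
od-f₁²⁴ = begin
  od ((f 1) ↑ 24)                                        ≈⟨ od-cong (pow-24 (f 1)) ⟩
  od (f₁⁸ · (f₁⁸ · f₁⁸))                                         ≈⟨ od-· f₁⁸ (f₁⁸ · f₁⁸) ⟩
  e · od (f₁⁸ · f₁⁸) ⊕ od f₁⁸ · ev (f₁⁸ · f₁⁸)
    ≈⟨ ⊕-cong (·-congˡ (od-· f₁⁸ f₁⁸)) (·-congˡ (ev-· f₁⁸ f₁⁸)) ⟩
  e · (e · od f₁⁸ ⊕ od f₁⁸ · e) ⊕ od f₁⁸ · (e · e ⊕ q · (od f₁⁸ · od f₁⁸))
    ≈⟨ solve 3 (λ q e o → e :* (e :* o :+ o :* e) :+ o :* (e :* e :+ q :* (o :* o))
         := con (+ 3) :* (e :* e) :* o :+ q :* (o :* o :* o)) ≋-refl q e (od f₁⁸) ⟩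
  const (+ 3) · (e · e) · od f₁⁸ ⊕ q · (od f₁⁸ · od f₁⁸ · od f₁⁸)
    ≈⟨ ⊕-cong (·-congˡ od-f₁⁸-f₂) (·-congˡ (·-cong (·-cong od-f₁⁸-f₂ od-f₁⁸-f₂) od-f₁⁸-f₂)) ⟩
  const (+ 3) · (e · e) · (const (- + 8) · f₂⁸) ⊕ q · ((const (- + 8) · f₂⁸) · (const (- + 8) · f₂⁸) · (const (- + 8) · f₂⁸))
    -- Completing -24 e² b to a multiple of the norm leaves -512 - 1536 = -2048 in front of q b³;
    -- here -512 = (-8)³ and 1536 = 24 · 64.
    ≈⟨ solve 3 (λ q e b → con (+ 3) :* (e :* e) :* (con (- + 8) :* b)
           :+ q :* ((con (- + 8) :* b) :* (con (- + 8) :* b) :* (con (- + 8) :* b))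
         := con (- + 24) :* ((e :* e :- con (+ 64) :* (q :* (b :* b))) :* b) :+ con (- + 2048) :* (q :* (b :* (b :* b))))
         ≋-refl q e f₂⁸ ⟩
  const (- + 24) · ((e · e ⊝ const (+ 64) · (q · (f₂⁸ · f₂⁸))) · f₂⁸) ⊕ const (- + 2048) · (q · (f₂⁸ · (f₂⁸ · f₂⁸)))
    ≈⟨ ⊕-cong (·-congˡ (≋-trans norm-f₁⁸ (≋-sym (pow-24 (f 1))))) (·-congˡ (·-congˡ (≋-sym (pow-24 (f 2))))) ⟩
  const (- + 24) · (f 1) ↑ 24 ⊕ const (- + 2048) · (q · (f 2) ↑ 24) ∎
  where
  open ≋-Reasoning
  e : PowerSeries
  e = ev f₁⁸

-- Solves the two halves of f₁⁻⁸ f₁⁸ = 1 for od f₁⁻⁸; the determinant is norm f₁⁸.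
f₁²⁴·od-f₁⁻⁸ : (f 1) ↑ 24 · od f₁⁻⁸ ≋ const (+ 8) · (f 2) ↑ 16
f₁²⁴·od-f₁⁻⁸ = begin
  (f 1) ↑ 24 · o
    ≈⟨ ·-congʳ (≋-trans (pow-24 (f 1)) (≋-sym norm-f₁⁸)) ⟩
  (e · e ⊝ const (+ 64) · (q · (f₂⁸ · f₂⁸))) · f₂⁸ · o
    ≈⟨ solve 5 (λ q e b o u → (e :* e :- con (+ 64) :* (q :* (b :* b))) :* b :* o
         := con (+ 8) :* (b :* b) :* (u :* e :+ q :* (o :* (con (- + 8) :* b))) :+ b :* e :* (u :* (con (- + 8) :* b) :+ o :* e))
         ≋-refl q e f₂⁸ o u ⟩
  const (+ 8) · (f₂⁸ · f₂⁸) · (u · e ⊕ q · (o · (const (- + 8) · f₂⁸))) ⊕ f₂⁸ · e · (u · (const (- + 8) · f₂⁸) ⊕ o · e)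
    ≈⟨ ⊕-cong (·-congˡ even-half) (·-congˡ odd-half) ⟩
  const (+ 8) · (f₂⁸ · f₂⁸) · one ⊕ f₂⁸ · e · const 0ℤ
    ≈⟨ solve 2 (λ b e → con (+ 8) :* (b :* b) :* :1 :+ b :* e :* con 0ℤ
         := con (+ 8) :* (b :* b)) ≋-refl f₂⁸ e ⟩
  const (+ 8) · (f₂⁸ · f₂⁸)                                ≈⟨ ·-congˡ (pow-16 (f 2)) ⟨
  const (+ 8) · (f 2) ↑ 16                           ∎
  where
  open ≋-Reasoning
  e o u : PowerSeries
  e = ev f₁⁸
  o = od f₁⁻⁸
  u = ev f₁⁻⁸
  even-half : u · e ⊕ q · (o · (const (- + 8) · f₂⁸)) ≋ one
  even-half = begin
    u · e ⊕ q · (o · (const (- + 8) · f₂⁸))   ≈⟨ ⊕-cong (≋-refl {u · e}) (·-congˡ (·-congˡ od-f₁⁸-f₂)) ⟨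
    u · e ⊕ q · (o · od f₁⁸)                  ≈⟨ ev-· f₁⁻⁸ f₁⁸ ⟨
    ev (f₁⁻⁸ · f₁⁸)                              ≈⟨ ev-cong f₁⁻⁸·f₁⁸ ⟩
    ev one                                  ≈⟨ ev-X^double 0 ⟩
    one                                     ∎
  odd-half : u · (const (- + 8) · f₂⁸) ⊕ o · e ≋ const 0ℤ
  odd-half = begin
    u · (const (- + 8) · f₂⁸) ⊕ o · e         ≈⟨ ⊕-cong (·-congˡ od-f₁⁸-f₂) (≋-refl {o · e}) ⟨
    u · od f₁⁸ ⊕ o · e                        ≈⟨ od-· f₁⁻⁸ f₁⁸ ⟨
    od (f₁⁻⁸ · f₁⁸)                              ≈⟨ od-cong f₁⁻⁸·f₁⁸ ⟩
    od one                                  ≈⟨ od-X^double 0 ⟩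
    const 0ℤ                                ∎

-- f₂²⁴ is a series in q², so it leaves the extraction as f₁²⁴, exactly the factor that
-- `f₁²⁴·od-f₁⁻⁸` carries.
ev-q·f₁⁻⁸·f₂²⁴ : ev (q · (f₁⁻⁸ · (f 2) ↑ 24)) ≋ const (+ 8) · (q · (f 2) ↑ 16)
ev-q·f₁⁻⁸·f₂²⁴ = begin
  ev (q · (f₁⁻⁸ · (f 2) ↑ 24))                    ≈⟨ ev-q· (f₁⁻⁸ · (f 2) ↑ 24) ⟩
  q · od (f₁⁻⁸ · (f 2) ↑ 24)                      ≈⟨ ·-congˡ (od-cong (·-comm f₁⁻⁸ ((f 2) ↑ 24))) ⟩
  q · od ((f 2) ↑ 24 · f₁⁻⁸)                      ≈⟨ ·-congˡ (od-cong (·-congʳ (E2-pow-f₁ 24))) ⟨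
  q · od (E2 ((f 1) ↑ 24) · f₁⁻⁸)                 ≈⟨ ·-congˡ (od-E2· ((f 1) ↑ 24) f₁⁻⁸) ⟩
  q · ((f 1) ↑ 24 · od f₁⁻⁸)                      ≈⟨ ·-congˡ f₁²⁴·od-f₁⁻⁸ ⟩
  q · (const (+ 8) · (f 2) ↑ 16)
    ≈⟨ solve 2 (λ q x → q :* (con (+ 8) :* x) := con (+ 8) :* (q :* x)) ≋-refl q ((f 2) ↑ 16) ⟩
  const (+ 8) · (q · (f 2) ↑ 16)               ∎
  where open ≋-Reasoning

od-f₁²⁴·f₂⁻⁸ : od ((f 1) ↑ 24 · f₂⁻⁸)
  ≋ const (- + 24) · (f 1) ↑ 16 ⊕ const (- + 2048) · (q · (f₁⁻⁸ · (f 2) ↑ 24))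
od-f₁²⁴·f₂⁻⁸ = begin
  od ((f 1) ↑ 24 · f₂⁻⁸)
    ≈⟨ od-cong (≋-trans (·-comm ((f 1) ↑ 24) f₂⁻⁸) (·-congʳ f₂⁻⁸≋E2f₁⁻⁸)) ⟩
  od (E2 f₁⁻⁸ · (f 1) ↑ 24)              ≈⟨ od-E2· f₁⁻⁸ ((f 1) ↑ 24) ⟩
  f₁⁻⁸ · od ((f 1) ↑ 24)                 ≈⟨ ·-congˡ od-f₁²⁴ ⟩
  f₁⁻⁸ · (const (- + 24) · (f 1) ↑ 24 ⊕ const (- + 2048) · (q · (f 2) ↑ 24))
    ≈⟨ ·-congˡ (⊕-cong (·-congˡ (pow-24 (f 1))) (≋-refl {const (- + 2048) · (q · (f 2) ↑ 24)})) ⟩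
  f₁⁻⁸ · (const (- + 24) · (f₁⁸ · (f₁⁸ · f₁⁸)) ⊕ const (- + 2048) · (q · (f 2) ↑ 24))
    ≈⟨ solve 4 (λ q i a l → i :* (con (- + 24) :* (a :* (a :* a)) :+ con (- + 2048) :* (q :* l))
         := con (- + 24) :* ((i :* a) :* (a :* a)) :+ con (- + 2048) :* (q :* (i :* l)))
              ≋-refl q f₁⁻⁸ f₁⁸ ((f 2) ↑ 24) ⟩
  const (- + 24) · ((f₁⁻⁸ · f₁⁸) · (f₁⁸ · f₁⁸)) ⊕ const (- + 2048) · (q · (f₁⁻⁸ · (f 2) ↑ 24))
    ≈⟨ ⊕-cong (·-congˡ (≋-trans (·-congʳ f₁⁻⁸·f₁⁸) (≋-trans (·-identityˡ (f₁⁸ · f₁⁸)) (≋-sym (pow-16 (f 1))))))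
              (≋-refl {const (- + 2048) · (q · (f₁⁻⁸ · (f 2) ↑ 24))}) ⟩
  const (- + 24) · (f 1) ↑ 16 ⊕ const (- + 2048) · (q · (f₁⁻⁸ · (f 2) ↑ 24)) ∎
  where
  open ≋-Reasoning

-- Second-order recurrences

-- The recurrence of A_k and B_k links indices two apart, so it decouples into second-order
-- recurrences for the even-indexed and the odd-indexed subsequence.
record LinearRecurrence (F G : ℤ) (x : ℕ → ℤ) : Set where
  constructor recurrence
  field recur : ∀ n → x (suc (suc n)) ≡ F * x (suc n) + G * x n

open LinearRecurrence

module _ {F G s₀ s₁ s₂ s₃ : ℤ} where

  recurrent-even : ∀ {x} → x ≡ recurrent F G s₀ s₁ s₂ s₃ → LinearRecurrence F G (λ n → x (double n))
  recurrent-even refl .recur n = refl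

  recurrent-odd : ∀ {x} → x ≡ recurrent F G s₀ s₁ s₂ s₃ → LinearRecurrence F G (λ n → x (suc (double n)))
  recurrent-odd refl .recur n = refl

recurrence-suc : ∀ {F G x} → LinearRecurrence F G x → LinearRecurrence F G (λ n → x (suc n))
recurrence-suc rec-x .recur n = recur rec-x (suc n)

-- Solutions of a second-order recurrence form a linear space and are determined by two values, so a
-- linear relation between the sequences only needs checking at 0 and 1, where it computes.
combination : ∀ {F G x y z} (c d : ℤ) →
  LinearRecurrence F G x → LinearRecurrence F G y → LinearRecurrence F G z →
  z 0 ≡ c * x 0 + d * y 0 → z 1 ≡ c * x 1 + d * y 1 → ∀ n → z n ≡ c * x n + d * y n
combination {F} {G} {x} {y} {z} c d rec-x rec-y rec-z z₀ z₁ = go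
  where
  open ≡-Reasoning
  rearrange : ∀ F G c d x x′ y y′ →
    F * (c * x′ + d * y′) + G * (c * x + d * y) ≡ c * (F * x′ + G * x) + d * (F * y′ + G * y)
  rearrange = solve-∀
  go : ∀ n → z n ≡ c * x n + d * y n
  go zero          = z₀
  go (suc zero)    = z₁
  go (suc (suc n)) = begin
    z (suc (suc n))                                               ≡⟨ recur rec-z n ⟩
    F * z (suc n) + G * z n
      ≡⟨ cong₂ (λ u v → F * u + G * v) (go (suc n)) (go n) ⟩
    F * (c * x (suc n) + d * y (suc n)) + G * (c * x n + d * y n)
      ≡⟨ rearrange F G c d (x n) (x (suc n)) (y n) (y (suc n)) ⟩
    c * (F * x (suc n) + G * x n) + d * (F * y (suc n) + G * y n)
      ≡⟨ cong₂ (λ u v → c * u + d * v) (recur rec-x n) (recur rec-y n) ⟨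
    c * x (suc (suc n)) + d * y (suc (suc n))                     ∎

-- Parity extraction as a matrix acting on coordinates

lin : ℤ → ℤ → PowerSeries → PowerSeries → PowerSeries
lin c d X Y = const c · X ⊕ const d · Y

-- The columns (m₁₁, m₂₁) and (m₁₂, m₂₂) hold the coordinates of the two dissected basis series.
lin-matrix : ∀ {c d m₁₁ m₁₂ m₂₁ m₂₂ W Z} →
  const c · lin m₁₁ m₂₁ W Z ⊕ const d · lin m₁₂ m₂₂ W Z ≋ lin (m₁₁ * c + m₁₂ * d) (m₂₁ * c + m₂₂ * d) W Z
lin-matrix {c} {d} {m₁₁} {m₁₂} {m₂₁} {m₂₂} {W} {Z} .at n = begin
  (const c · lin m₁₁ m₂₁ W Z) n + (const d · lin m₁₂ m₂₂ W Z) n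
    ≡⟨ cong₂ _+_ (trans (const-· c (lin m₁₁ m₂₁ W Z) n) (cong (c *_) (cong₂ _+_ (const-· m₁₁ W n) (const-· m₂₁ Z n))))
                 (trans (const-· d (lin m₁₂ m₂₂ W Z) n) (cong (d *_) (cong₂ _+_ (const-· m₁₂ W n) (const-· m₂₂ Z n)))) ⟩
  c * (m₁₁ * W n + m₂₁ * Z n) + d * (m₁₂ * W n + m₂₂ * Z n)
    ≡⟨ rearrange c d m₁₁ m₁₂ m₂₁ m₂₂ (W n) (Z n) ⟩
  (m₁₁ * c + m₁₂ * d) * W n + (m₂₁ * c + m₂₂ * d) * Z n
    ≡⟨ cong₂ _+_ (const-· (m₁₁ * c + m₁₂ * d) W n) (const-· (m₂₁ * c + m₂₂ * d) Z n) ⟨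
  lin (m₁₁ * c + m₁₂ * d) (m₂₁ * c + m₂₂ * d) W Z n ∎
  where
  open ≡-Reasoning
  rearrange : ∀ c d m₁₁ m₁₂ m₂₁ m₂₂ w z → c * (m₁₁ * w + m₂₁ * z) + d * (m₁₂ * w + m₂₂ * z)
    ≡ (m₁₁ * c + m₁₂ * d) * w + (m₂₁ * c + m₂₂ * d) * z
  rearrange = solve-∀

≡⇒lin≋ : ∀ {c c′ d d′} X Y → c ≡ c′ → d ≡ d′ → lin c d X Y ≋ lin c′ d′ X Y
≡⇒lin≋ X Y refl refl = ≋-refl

module _ {c d c′ d′ : ℤ} {s X Y W Z : PowerSeries} (m₁₁ m₁₂ m₂₁ m₂₂ : ℤ)
         (s≋ : s ≋ lin c d X Y) (c′≡ : c′ ≡ m₁₁ * c + m₁₂ * d) (d′≡ : d′ ≡ m₂₁ * c + m₂₂ * d) where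
  open ≋-Reasoning

  ev-lin : ev X ≋ lin m₁₁ m₂₁ W Z → ev Y ≋ lin m₁₂ m₂₂ W Z → ev s ≋ lin c′ d′ W Z
  ev-lin evX evY = begin
    ev s                                              ≈⟨ ev-cong s≋ ⟩
    ev (const c · X) ⊕ ev (const d · Y)               ≈⟨ ⊕-cong (ev-const· c X) (ev-const· d Y) ⟩
    const c · ev X ⊕ const d · ev Y                   ≈⟨ ⊕-cong (·-congˡ evX) (·-congˡ evY) ⟩
    const c · lin m₁₁ m₂₁ W Z ⊕ const d · lin m₁₂ m₂₂ W Z
      ≈⟨ lin-matrix {c} {d} {m₁₁} {m₁₂} {m₂₁} {m₂₂} {W} {Z} ⟩
    lin (m₁₁ * c + m₁₂ * d) (m₂₁ * c + m₂₂ * d) W Z   ≈⟨ ≡⇒lin≋ W Z c′≡ d′≡ ⟨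
    lin c′ d′ W Z                                     ∎

  od-lin : od X ≋ lin m₁₁ m₂₁ W Z → od Y ≋ lin m₁₂ m₂₂ W Z → od s ≋ lin c′ d′ W Z
  od-lin odX odY = begin
    od s                                              ≈⟨ od-cong s≋ ⟩
    od (const c · X) ⊕ od (const d · Y)               ≈⟨ ⊕-cong (od-const· c X) (od-const· d Y) ⟩
    const c · od X ⊕ const d · od Y                   ≈⟨ ⊕-cong (·-congˡ odX) (·-congˡ odY) ⟩
    const c · lin m₁₁ m₂₁ W Z ⊕ const d · lin m₁₂ m₂₂ W Z
      ≈⟨ lin-matrix {c} {d} {m₁₁} {m₁₂} {m₂₁} {m₂₂} {W} {Z} ⟩
    lin (m₁₁ * c + m₁₂ * d) (m₂₁ * c + m₂₂ * d) W Z   ≈⟨ ≡⇒lin≋ W Z c′≡ d′≡ ⟨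
    lin c′ d′ W Z                                     ∎

-- The arithmetic progressions

-- The geometric sum 1 + 4 + ... + 4^(α-1), which keeps division out of the induction.
⅓[4^_-1] : ℕ → ℕ
⅓[4^ zero -1]  = 0
⅓[4^ suc α -1] = 2 ℕ.^ double α ℕ.+ ⅓[4^ α -1]

first : ℕ → ℕ → PowerSeries
first k α n = (f 1 ↑ (8 ℕ.* k)) (2 ℕ.^ double α ℕ.* n ℕ.+ k ℕ.* ⅓[4^ α -1])

first-zero : ∀ k → first k 0 ≋ f 1 ↑ (8 ℕ.* k)
first-zero k .at n = cong (f 1 ↑ (8 ℕ.* k)) (begin
  n ℕ.+ 0 ℕ.+ k ℕ.* 0     ≡⟨ cong₂ ℕ._+_ (ℕₚ.+-identityʳ n) (ℕₚ.*-zeroʳ k) ⟩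
  n ℕ.+ 0                 ≡⟨ ℕₚ.+-identityʳ n ⟩
  n                       ∎)
  where open ≡-Reasoning

-- Since k(4^(α+1) - 1)/3 = 4^α k + k(4^α - 1)/3, raising α by one selects the indices 4n + k. For k
-- < 4 this amounts to two parity extractions, chosen by the binary digits of k.
first-suc : ∀ k α n → first k (suc α) n ≡ first k α (k ℕ.+ double (double n))
first-suc k α n = cong (f 1 ↑ (8 ℕ.* k)) (begin
  2 ℕ.* (2 ℕ.* N) ℕ.* n ℕ.+ k ℕ.* (N ℕ.+ ⅓[4^ α -1])
    ≡⟨ rearrange N n k ⅓[4^ α -1] ⟩
  N ℕ.* (k ℕ.+ n ℕ.* 2 ℕ.* 2) ℕ.+ k ℕ.* ⅓[4^ α -1]
    ≡⟨ cong (λ m → N ℕ.* (k ℕ.+ m) ℕ.+ k ℕ.* ⅓[4^ α -1]) (trans (cong (ℕ._* 2) (double≡*2 n)) (double≡*2 (double n))) ⟩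
  N ℕ.* (k ℕ.+ double (double n)) ℕ.+ k ℕ.* ⅓[4^ α -1] ∎)
  where
  open ≡-Reasoning
  N : ℕ
  N = 2 ℕ.^ double α
  rearrange : ∀ N n k g → 2 ℕ.* (2 ℕ.* N) ℕ.* n ℕ.+ k ℕ.* (N ℕ.+ g) ≡ N ℕ.* (k ℕ.+ n ℕ.* 2 ℕ.* 2) ℕ.+ k ℕ.* g
  rearrange = solve-∀ₙ

-- Transition relations for A_k and B_k

A₁-recurrence-even : LinearRecurrence (recF 1) (recG 1) (λ n → A 1 (double n))
A₁-recurrence-even = recurrent-even refl

A₁-recurrence-odd : LinearRecurrence (recF 1) (recG 1) (λ n → A 1 (suc (double n)))
A₁-recurrence-odd = recurrent-odd refl

zero-recurrence : LinearRecurrence (recF 1) (recG 1) (λ _ → 0ℤ)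
zero-recurrence .recur n = refl

A₂-recurrence-even : LinearRecurrence (recF 2) (recG 2) (λ n → A 2 (double n))
A₂-recurrence-even = recurrent-even refl

A₂-recurrence-odd : LinearRecurrence (recF 2) (recG 2) (λ n → A 2 (suc (double n)))
A₂-recurrence-odd = recurrent-odd refl

B₂-recurrence-even : LinearRecurrence (recF 2) (recG 2) (λ n → B 2 (double n))
B₂-recurrence-even = recurrent-even refl

B₂-recurrence-odd : LinearRecurrence (recF 2) (recG 2) (λ n → B 2 (suc (double n)))
B₂-recurrence-odd = recurrent-odd refl

A₃-recurrence-even : LinearRecurrence (recF 3) (recG 3) (λ n → A 3 (double n))
A₃-recurrence-even = recurrent-even refl

A₃-recurrence-odd : LinearRecurrence (recF 3) (recG 3) (λ n → A 3 (suc (double n)))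
A₃-recurrence-odd = recurrent-odd refl

B₃-recurrence-even : LinearRecurrence (recF 3) (recG 3) (λ n → B 3 (double n))
B₃-recurrence-even = recurrent-even refl

B₃-recurrence-odd : LinearRecurrence (recF 3) (recG 3) (λ n → B 3 (suc (double n)))
B₃-recurrence-odd = recurrent-odd refl

A₁-odd : ∀ α → A 1 (suc (double α)) ≡ (- + 8) * A 1 (double α) + 0ℤ * 0ℤ
A₁-odd = combination {x = λ n → A 1 (double n)} {λ _ → 0ℤ} {λ n → A 1 (suc (double n))} (- + 8) 0ℤ
  A₁-recurrence-even zero-recurrence A₁-recurrence-odd refl refl

A₁-even : ∀ α → A 1 (double (suc α)) ≡ 1ℤ * A 1 (suc (double α)) + 0ℤ * 0ℤ
A₁-even = combination {x = λ n → A 1 (suc (double n))} {λ _ → 0ℤ} {λ n → A 1 (double (suc n))} 1ℤ 0ℤ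
  A₁-recurrence-odd zero-recurrence (recurrence-suc A₁-recurrence-even) refl refl

-- The matrix (128 8; 1 0) has as columns the coordinates found in `ev-f₁¹⁶` and `ev-q·f₁⁻⁸·f₂²⁴`.
A₂-odd : ∀ α → A 2 (suc (double α)) ≡ (+ 128) * A 2 (double α) + (+ 8) * B 2 (double α)
A₂-odd = combination {x = λ n → A 2 (double n)} {λ n → B 2 (double n)} {λ n → A 2 (suc (double n))} (+ 128) (+ 8)
  A₂-recurrence-even B₂-recurrence-even A₂-recurrence-odd refl refl

B₂-odd : ∀ α → B 2 (suc (double α)) ≡ 1ℤ * A 2 (double α) + 0ℤ * B 2 (double α)
B₂-odd = combination {x = λ n → A 2 (double n)} {λ n → B 2 (double n)} {λ n → B 2 (suc (double n))} 1ℤ 0ℤ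
  A₂-recurrence-even B₂-recurrence-even B₂-recurrence-odd refl refl

-- The matrix (1 -24; 0 -2048): q f₂¹⁶ returns to f₁¹⁶, and the second column is `od-f₁²⁴·f₂⁻⁸`.
A₂-even : ∀ α → A 2 (double (suc α)) ≡ 1ℤ * A 2 (suc (double α)) + (- + 24) * B 2 (suc (double α))
A₂-even = combination {x = λ n → A 2 (suc (double n))} {λ n → B 2 (suc (double n))} {λ n → A 2 (double (suc n))} 1ℤ (- + 24)
  A₂-recurrence-odd B₂-recurrence-odd (recurrence-suc A₂-recurrence-even) refl refl

B₂-even : ∀ α → B 2 (double (suc α)) ≡ 0ℤ * A 2 (suc (double α)) + (- + 2048) * B 2 (suc (double α))
B₂-even = combination {x = λ n → A 2 (suc (double n))} {λ n → B 2 (suc (double n))} {λ n → B 2 (double (suc n))} 0ℤ (- + 2048)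
  A₂-recurrence-odd B₂-recurrence-odd (recurrence-suc B₂-recurrence-even) refl refl

-- The second identity lists its f₂ term before its f₁ term, so `od-f₁²⁴` enters with -2048 in the
-- first row and -24 in the second.
A₃-odd : ∀ α → A 3 (suc (double α)) ≡ (- + 2048) * A 3 (double α) + 0ℤ * B 3 (double α)
A₃-odd = combination {x = λ n → A 3 (double n)} {λ n → B 3 (double n)} {λ n → A 3 (suc (double n))} (- + 2048) 0ℤ
  A₃-recurrence-even B₃-recurrence-even A₃-recurrence-odd refl refl

B₃-odd : ∀ α → B 3 (suc (double α)) ≡ (- + 24) * A 3 (double α) + 1ℤ * B 3 (double α)
B₃-odd = combination {x = λ n → A 3 (double n)} {λ n → B 3 (double n)} {λ n → B 3 (suc (double n))} (- + 24) 1ℤ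
  A₃-recurrence-even B₃-recurrence-even B₃-recurrence-odd refl refl

A₃-even : ∀ α → A 3 (double (suc α)) ≡ 1ℤ * A 3 (suc (double α)) + (- + 24) * B 3 (suc (double α))
A₃-even = combination {x = λ n → A 3 (suc (double n))} {λ n → B 3 (suc (double n))} {λ n → A 3 (double (suc n))} 1ℤ (- + 24)
  A₃-recurrence-odd B₃-recurrence-odd (recurrence-suc A₃-recurrence-even) refl refl

B₃-even : ∀ α → B 3 (double (suc α)) ≡ 0ℤ * A 3 (suc (double α)) + (- + 2048) * B 3 (suc (double α))
B₃-even = combination {x = λ n → A 3 (suc (double n))} {λ n → B 3 (suc (double n))} {λ n → B 3 (double (suc n))} 0ℤ (- + 2048)
  A₃-recurrence-odd B₃-recurrence-odd (recurrence-suc B₃-recurrence-even) refl refl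

-- Induction on α for power series

lin-1-0 : ∀ X Y → X ≋ lin 1ℤ 0ℤ X Y
lin-1-0 = solve 2 (λ X Y → X := con 1ℤ :* X :+ con 0ℤ :* Y) ≋-refl

lin-c-0 : ∀ c X Y → const c · X ≋ lin c 0ℤ X Y
lin-c-0 c X Y = solve 3 (λ c X Y → c :* X := c :* X :+ con 0ℤ :* Y) ≋-refl (const c) X Y

lin-c-1 : ∀ c X Y → const c · X ⊕ Y ≋ lin c 1ℤ X Y
lin-c-1 c X Y = solve 3 (λ c X Y → c :* X :+ Y := c :* X :+ con 1ℤ :* Y) ≋-refl (const c) X Y

lin-comm : ∀ c d X Y → lin c d X Y ≋ lin d c Y X
lin-comm c d X Y = solve 2 (λ x y → x :+ y := y :+ x) ≋-refl (const c · X) (const d · Y)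

0≋lin : ∀ X → const 0ℤ ≋ lin 0ℤ 0ℤ X (const 0ℤ)
0≋lin = solve 1 (λ X → con 0ℤ := con 0ℤ :* X :+ con 0ℤ :* con 0ℤ) ≋-refl

mutual
  first₁ : ∀ α → first 1 α ≋ lin (A 1 (double α)) 0ℤ (f 1 ↑ 8) (const 0ℤ)
  first₁ zero    = ≋-trans (first-zero 1) (lin-1-0 (f 1 ↑ 8) (const 0ℤ))
  -- The index 1 + 4n computes to the even part of the odd part. In the same way 2 + 4n gives the
  -- odd part of the even part, and 3 + 4n the odd part of the odd part.
  first₁ (suc α) = ≋-trans (mk≋ (first-suc 1 α))
    (ev-lin 1ℤ 0ℤ 0ℤ 0ℤ (second₁ α) (A₁-even α) refl
      (≋-trans (ev-pow-f₂ 8) (lin-1-0 (f 1 ↑ 8) (const 0ℤ)))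
      (≋-trans (ev-const 0ℤ) (0≋lin (f 1 ↑ 8))))

  second₁ : ∀ α → od (first 1 α) ≋ lin (A 1 (suc (double α))) 0ℤ (f 2 ↑ 8) (const 0ℤ)
  second₁ α = od-lin (- + 8) 0ℤ 0ℤ 0ℤ (first₁ α) (A₁-odd α) refl
    (≋-trans od-f₁⁸-f₂ (lin-c-0 (- + 8) (f 2 ↑ 8) (const 0ℤ)))
    (≋-trans (od-const 0ℤ) (0≋lin (f 2 ↑ 8)))

-- For k = 2 and k = 3 the second identity is multiplied by q, to make both of its terms power series.
mutual
  first₂ : ∀ α → first 2 α ≋ lin (A 2 (double α)) (B 2 (double α)) (f 1 ↑ 16) (q · (f₁⁻⁸ · f 2 ↑ 24))
  first₂ zero    = ≋-trans (first-zero 2) (lin-1-0 (f 1 ↑ 16) (q · (f₁⁻⁸ · f 2 ↑ 24)))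
  first₂ (suc α) = ≋-trans (mk≋ (first-suc 2 α))
    (od-lin 1ℤ (- + 24) 0ℤ (- + 2048) (second₂ α) (A₂-even α) (B₂-even α)
      (≋-trans (od-q· (f 2 ↑ 16)) (≋-trans (ev-pow-f₂ 16) (lin-1-0 (f 1 ↑ 16) (q · (f₁⁻⁸ · f 2 ↑ 24)))))
      od-f₁²⁴·f₂⁻⁸)

  second₂ : ∀ α → ev (first 2 α)
    ≋ lin (A 2 (suc (double α))) (B 2 (suc (double α))) (q · f 2 ↑ 16) (f 1 ↑ 24 · f₂⁻⁸)
  second₂ α = ev-lin (+ 128) (+ 8) 1ℤ 0ℤ (first₂ α) (A₂-odd α) (B₂-odd α)
    (≋-trans ev-f₁¹⁶ (lin-c-1 (+ 128) (q · f 2 ↑ 16) (f 1 ↑ 24 · f₂⁻⁸)))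
    (≋-trans ev-q·f₁⁻⁸·f₂²⁴ (lin-c-0 (+ 8) (q · f 2 ↑ 16) (f 1 ↑ 24 · f₂⁻⁸)))

mutual
  first₃ : ∀ α → first 3 α ≋ lin (A 3 (double α)) (B 3 (double α)) (f 1 ↑ 24) (q · f 2 ↑ 24)
  first₃ zero    = ≋-trans (first-zero 3) (lin-1-0 (f 1 ↑ 24) (q · f 2 ↑ 24))
  first₃ (suc α) = ≋-trans (mk≋ (first-suc 3 α))
    (od-lin 1ℤ (- + 24) 0ℤ (- + 2048) (second₃ α) (A₃-even α) (B₃-even α)
      (≋-trans od-q·f₂²⁴ (lin-1-0 (f 1 ↑ 24) (q · f 2 ↑ 24)))
      od-f₁²⁴)

  second₃ : ∀ α → od (first 3 α)
    ≋ lin (A 3 (suc (double α))) (B 3 (suc (double α))) (q · f 2 ↑ 24) (f 1 ↑ 24)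
  second₃ α = od-lin (- + 2048) 0ℤ (- + 24) 1ℤ (first₃ α) (A₃-odd α) (B₃-odd α)
    (≋-trans od-f₁²⁴ (lin-comm (- + 24) (- + 2048) (f 1 ↑ 24) (q · f 2 ↑ 24)))
    (≋-trans od-q·f₂²⁴ (≋-trans (lin-1-0 (f 1 ↑ 24) (q · f 2 ↑ 24)) (lin-comm 1ℤ 0ℤ (f 1 ↑ 24) (q · f 2 ↑ 24))))

  od-q·f₂²⁴ : od (q · f 2 ↑ 24) ≋ f 1 ↑ 24
  od-q·f₂²⁴ = ≋-trans (od-q· (f 2 ↑ 24)) (ev-pow-f₂ 24)

-- From power series to Laurent series

⅓[4^-1]*3 : ∀ α → 2 ℕ.^ double α ∸ 1 ≡ ⅓[4^ α -1] ℕ.* 3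
⅓[4^-1]*3 α = cong (_∸ 1) (go α)
  where
  rearrange : ∀ N g → N ≡ suc (g ℕ.* 3) → 2 ℕ.* (2 ℕ.* N) ≡ suc ((N ℕ.+ g) ℕ.* 3)
  rearrange _ g refl = lemma g
    where
    lemma : ∀ g → 2 ℕ.* (2 ℕ.* suc (g ℕ.* 3)) ≡ suc ((suc (g ℕ.* 3) ℕ.+ g) ℕ.* 3)
    lemma = solve-∀ₙ
  go : ∀ α → 2 ℕ.^ double α ≡ suc (⅓[4^ α -1] ℕ.* 3)
  go zero    = refl
  go (suc α) = rearrange (2 ℕ.^ double α) ⅓[4^ α -1] (go α)

k[4^-1]/3 : ∀ k α → (k ℕ.* (2 ℕ.^ double α ∸ 1)) / 3 ≡ k ℕ.* ⅓[4^ α -1]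
k[4^-1]/3 k α = begin
  (k ℕ.* (2 ℕ.^ double α ∸ 1)) / 3      ≡⟨ cong (λ m → (k ℕ.* m) / 3) (⅓[4^-1]*3 α) ⟩
  (k ℕ.* (⅓[4^ α -1] ℕ.* 3)) / 3        ≡⟨ cong (_/ 3) (ℕₚ.*-assoc k ⅓[4^ α -1] 3) ⟨
  (k ℕ.* ⅓[4^ α -1] ℕ.* 3) / 3          ≡⟨ m*n/n≡m (k ℕ.* ⅓[4^ α -1]) 3 ⟩
  k ℕ.* ⅓[4^ α -1]                      ∎
  where open ≡-Reasoning

p-ℕ : ∀ n {x} m → x ≡ + m → p (+ n) x ≡ (f 1 ↑ n) m
p-ℕ n m refl = trans (cong (λ k → pow (f 1) n k) (ℕₚ.+-identityʳ m)) (sym (at (↑≋pow (f 1) n) m))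

p-first : ∀ k α n →
  p (+ (8 ℕ.* k)) (+ (2 ℕ.^ double α) * + n + + ((k ℕ.* (2 ℕ.^ double α ∸ 1)) / 3)) ≡ first k α n
p-first k α n = p-ℕ (8 ℕ.* k) (2 ℕ.^ double α ℕ.* n ℕ.+ k ℕ.* ⅓[4^ α -1]) (begin
  + N * + n + + ((k ℕ.* (N ∸ 1)) / 3)     ≡⟨ cong (λ m → + N * + n + + m) (k[4^-1]/3 k α) ⟩
  + N * + n + + (k ℕ.* ⅓[4^ α -1])        ≡⟨ cong (_+ + (k ℕ.* ⅓[4^ α -1])) (ℤₚ.pos-* N n) ⟨
  + (N ℕ.* n) + + (k ℕ.* ⅓[4^ α -1])      ≡⟨ ℤₚ.pos-+ (N ℕ.* n) (k ℕ.* ⅓[4^ α -1]) ⟨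
  + (N ℕ.* n ℕ.+ k ℕ.* ⅓[4^ α -1])        ∎)
  where
  open ≡-Reasoning
  N : ℕ
  N = 2 ℕ.^ double α

-- Write k = 2h + r. Starting the sum at -h subtracts 2h · 4^α from the index and leaves 4^α (2n +
-- r) + k(4^α - 1)/3, so the parity r of k decides which half of the first series appears.
p-second : ∀ k h r α n → k ≡ h ℕ.+ h ℕ.+ r →
  p (+ (8 ℕ.* k)) (+ (2 ℕ.^ suc (double α)) * (- (+ h) + + n) + + ((k ℕ.* (2 ℕ.^ suc (suc (double α)) ∸ 1)) / 3))
    ≡ first k α (r ℕ.+ double n)
p-second k h r α n k≡ = p-ℕ (8 ℕ.* k) (N ℕ.* (r ℕ.+ double n) ℕ.+ k ℕ.* g′) (begin
  + (2 ℕ.* N) * (- (+ h) + + n) + + ((k ℕ.* (2 ℕ.^ double (suc α) ∸ 1)) / 3)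
    ≡⟨ cong (λ m → + (2 ℕ.* N) * (- (+ h) + + n) + + m) (k[4^-1]/3 k (suc α)) ⟩
  + (2 ℕ.* N) * (- (+ h) + + n) + + (k ℕ.* (N ℕ.+ g′))
    ≡⟨ cong₂ (λ x y → x * (- (+ h) + + n) + y) (ℤₚ.pos-* 2 N) (trans (ℤₚ.pos-* k (N ℕ.+ g′)) (cong₂ _*_ k≡ℤ (ℤₚ.pos-+ N g′))) ⟩
  + 2 * + N * (- (+ h) + + n) + (+ h + + h + + r) * (+ N + + g′)
    ≡⟨ rearrange (+ N) (+ h) (+ n) (+ r) (+ g′) ⟩
  + N * (+ r + + n * + 2) + (+ h + + h + + r) * + g′
    ≡⟨ cong₂ _+_ (cong (+ N *_) (trans (ℤₚ.pos-+ r (double n)) (cong (λ x → + r + x) (trans (cong +_ (sym (double≡*2 n))) (ℤₚ.pos-* n 2)))))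
                 (trans (ℤₚ.pos-* k g′) (cong (_* + g′) k≡ℤ)) ⟨
  + N * + (r ℕ.+ double n) + + (k ℕ.* g′)
    ≡⟨ cong (_+ + (k ℕ.* g′)) (ℤₚ.pos-* N (r ℕ.+ double n)) ⟨
  + (N ℕ.* (r ℕ.+ double n)) + + (k ℕ.* g′)
    ≡⟨ ℤₚ.pos-+ (N ℕ.* (r ℕ.+ double n)) (k ℕ.* g′) ⟨
  + (N ℕ.* (r ℕ.+ double n) ℕ.+ k ℕ.* g′) ∎)
  where
  open ≡-Reasoning
  N g′ : ℕ
  N = 2 ℕ.^ double α
  g′ = ⅓[4^ α -1]
  k≡ℤ : + k ≡ + h + + h + + r
  k≡ℤ = cong +_ k≡
  rearrange : ∀ N h n r g → + 2 * N * (- h + n) + (h + h + r) * (N + g) ≡ N * (r + n * + 2) + (h + h + r) * g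
  rearrange = solve-∀

lin-at : ∀ {X₀ X Y₀ Y} c d → X₀ ≋ X → Y₀ ≋ Y → ∀ n → c * X₀ n + d * Y₀ n ≡ lin c d X Y n
lin-at {X = X} {Y = Y} c d X₀≋ Y₀≋ n =
  cong₂ _+_ (trans (cong (c *_) (at X₀≋ n)) (sym (const-· c X n)))
            (trans (cong (d *_) (at Y₀≋ n)) (sym (const-· d Y n)))

coeff-0 : ∀ a n → coeff (laurent (+ 0) a) (+ n) ≡ a n
coeff-0 a n = cong a (ℕₚ.+-identityʳ n)

coeff-1 : ∀ d a n → coeff (d • laurent (+ 1) a) (+ n) ≡ d * (q · a) n
coeff-1 d a zero    = sym (trans (cong (d *_) (q·-zero a)) (ℤₚ.*-zeroʳ d))
coeff-1 d a (suc n) = cong (d *_) (sym (q·-suc a n))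

coeff-0-shift : ∀ d a n → coeff (d • laurent (+ 0) a) (- (+ 1) + + n) ≡ d * (q · a) n
coeff-0-shift d a zero    = sym (trans (cong (d *_) (q·-zero a)) (ℤₚ.*-zeroʳ d))
coeff-0-shift d a (suc n) = trans (coeff-0 (λ m → d * a m) n) (cong (d *_) (sym (q·-suc a n)))

coeff-−1-shift : ∀ a n → coeff (laurent (- (+ 1)) a) (- (+ 1) + + n) ≡ a n
coeff-−1-shift a zero    = refl
coeff-−1-shift a (suc n) = cong a (ℕₚ.+-comm n 1)

-- The left-hand side is the tail of `q^ v ⊠ ⟦ x₀ ⟧ ⊠ ⟦ y₀ ⟧`: the monomial keeps its exponent in
-- `low` and contributes `one` to the tail.
one⊛⊛ : ∀ x₀ y₀ {x y} → x₀ ≋ x → y₀ ≋ y → (one ⊛ x₀) ⊛ y₀ ≋ x · y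
one⊛⊛ x₀ y₀ {x} {y} x₀≋ y₀≋ = begin
  (one ⊛ x₀) ⊛ y₀     ≈⟨ ·≋⊛ (one ⊛ x₀) y₀ ⟨
  (one ⊛ x₀) · y₀     ≈⟨ ·-cong (⊛-identityˡ x₀) y₀≋ ⟩
  x₀ · y              ≈⟨ ·-congʳ x₀≋ ⟩
  x · y               ∎
  where open ≋-Reasoning

^≋↑ : ∀ a n → a ^ (+ n) ≋ a ↑ n
^≋↑ a n = ≋-sym (↑≋pow a n)

^-negative≋↑ : ∀ a z n → z ≡ -[1+ n ] → a ^ z ≋ inv a ↑ suc n
^-negative≋↑ a z n refl = ≋-sym (↑≋pow (inv a) (suc n))

^-zero≋one : ∀ a z → z ≡ + 0 → a ^ z ≋ one
^-zero≋one a z refl = ≋-refl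

-- Below the common lowest exponent both sides are 0 by the definition of `extend`, so only the
-- exponents v + n remain to be compared.
∑≥-≈-⊞ : ∀ v c x y → Laurent.low x ℤ.⊓ Laurent.low y ≡ v →
  (∀ n → c (v + + n) ≡ coeff x (v + + n) + coeff y (v + + n)) → ∑≥ v c ≈ x ⊞ y
∑≥-≈-⊞ v c x y refl c≡ m with m - v
... | + n      = c≡ n
... | -[1+ n ] = refl

module _ (v : ℤ) (c : ℤ → ℤ) (A B : ℤ) (X₀ x₀ y₀ : PowerSeries)
         {s X Y : PowerSeries} (X₀≋X : X₀ ≋ X) (Y₀≋Y : (one ⊛ x₀) ⊛ y₀ ≋ Y) where

  private
    Y₀ : PowerSeries
    Y₀ = (one ⊛ x₀) ⊛ y₀

  ∑≥-≈-⊞-0 : v ≡ + 0 → s ≋ lin A 0ℤ X (const 0ℤ) → B ≡ 0ℤ → (∀ n → c (+ n) ≡ s n) →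
    ∑≥ (+ 0) c ≈ A • ⟦ X₀ ⟧ ⊞ B • (q^ v ⊠ ⟦ x₀ ⟧ ⊠ ⟦ y₀ ⟧)
  ∑≥-≈-⊞-0 refl s≋ refl c≡ = ∑≥-≈-⊞ (+ 0) c (A • ⟦ X₀ ⟧) (0ℤ • (q^ (+ 0) ⊠ ⟦ x₀ ⟧ ⊠ ⟦ y₀ ⟧)) refl λ n →
    trans (c≡ n) (trans (at s≋ n) (sym (trans
      (cong₂ _+_ (coeff-0 (λ m → A * X₀ m) n) (coeff-0 (λ m → 0ℤ * Y₀ m) n))
      (lin-at A 0ℤ X₀≋X (≋-refl {const 0ℤ}) n))))

  ∑≥-≈-⊞-1 : v ≡ + 1 → s ≋ lin A B X (q · Y) → (∀ n → c (+ n) ≡ s n) →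
    ∑≥ (+ 0) c ≈ A • ⟦ X₀ ⟧ ⊞ B • (q^ v ⊠ ⟦ x₀ ⟧ ⊠ ⟦ y₀ ⟧)
  ∑≥-≈-⊞-1 refl s≋ c≡ = ∑≥-≈-⊞ (+ 0) c (A • ⟦ X₀ ⟧) (B • (q^ (+ 1) ⊠ ⟦ x₀ ⟧ ⊠ ⟦ y₀ ⟧)) refl λ n →
    trans (c≡ n) (trans (at s≋ n) (sym (trans
      (cong₂ _+_ (coeff-0 (λ m → A * X₀ m) n) (coeff-1 B Y₀ n))
      (lin-at A B X₀≋X (·-congˡ Y₀≋Y) n))))

  -- Counting coefficients from exponent -1 amounts to multiplying by q, which turns X into q X and
  -- absorbs the q⁻¹ in front of Y.
  ∑≥-≈-⊞-−1 : v ≡ - (+ 1) → s ≋ lin A B (q · X) Y → (∀ n → c (- (+ 1) + + n) ≡ s n) →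
    ∑≥ v c ≈ A • ⟦ X₀ ⟧ ⊞ B • (q^ v ⊠ ⟦ x₀ ⟧ ⊠ ⟦ y₀ ⟧)
  ∑≥-≈-⊞-−1 refl s≋ c≡ = ∑≥-≈-⊞ (- (+ 1)) c (A • ⟦ X₀ ⟧) (B • (q^ (- (+ 1)) ⊠ ⟦ x₀ ⟧ ⊠ ⟦ y₀ ⟧)) refl λ n →
    trans (c≡ n) (trans (at s≋ n) (sym (trans
      (cong₂ _+_ (coeff-0-shift A X₀ n) (coeff-−1-shift (λ m → B * Y₀ m) n))
      (lin-at A B (·-congˡ X₀≋X) Y₀≋Y n))))

-- The two identities for k = 1, 2, 3

coefficients₁ : ℕ → ℕ → ℤ → ℤ
coefficients₁ k n m = p (+ (8 ℕ.* k)) (+ (2 ℕ.^ n) * m + + ((k ℕ.* (2 ℕ.^ n ∸ 1)) / 3))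

coefficients₂ : ℕ → ℕ → ℕ → ℤ → ℤ
coefficients₂ k n n′ m = p (+ (8 ℕ.* k)) (+ (2 ℕ.^ n) * m + + ((k ℕ.* (2 ℕ.^ n′ ∸ 1)) / 3))

FirstIdentity : ℕ → ℕ → Set
FirstIdentity k n = ∑≥ (+ 0) (coefficients₁ k n)
  ≈ A k n • ⟦ f 1 ^ (+ (8 ℕ.* k)) ⟧
    ⊞ B k n • (q^ (+ ⌊ k /2⌋) ⊠ ⟦ f 1 ^ (+ (8 ℕ.* k) - + 24) ⟧ ⊠ ⟦ f 2 ^ (+ 24) ⟧)

-- Both exponents of 2 are parameters, so that `2 * α + 1` and `2 * α + 2` can be exchanged for
-- expressions in `double α`, on which the recursions compute.
SecondIdentity : ℕ → ℕ → ℕ → Set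
SecondIdentity k n n′ = ∑≥ (- (+ ⌊ k /2⌋)) (coefficients₂ k n n′)
  ≈ A k n • ⟦ f 2 ^ (+ (8 ℕ.* k)) ⟧
    ⊞ B k n • (q^ (- (+ ⌊ k /2⌋)) ⊠ ⟦ f 1 ^ (+ 24) ⟧ ⊠ ⟦ f 2 ^ (+ (8 ℕ.* k) - + 24) ⟧)

first-identity₁ : ∀ α → FirstIdentity 1 (double α)
first-identity₁ α = ∑≥-≈-⊞-0 (+ ⌊ 1 /2⌋) (coefficients₁ 1 (double α)) (A 1 (double α)) (B 1 (double α))
  (f 1 ^ (+ (8 ℕ.* 1))) (f 1 ^ (+ (8 ℕ.* 1) - + 24)) (f 2 ^ (+ 24))
  (^≋↑ (f 1) (8 ℕ.* 1))
  (one⊛⊛ (f 1 ^ (+ (8 ℕ.* 1) - + 24)) (f 2 ^ (+ 24)) (^-negative≋↑ (f 1) (+ (8 ℕ.* 1) - + 24) 15 refl) (^≋↑ (f 2) 24))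
  refl (first₁ α) refl (p-first 1 α)

second-identity₁ : ∀ α → SecondIdentity 1 (suc (double α)) (double (suc α))
second-identity₁ α =
  ∑≥-≈-⊞-0 (- (+ ⌊ 1 /2⌋)) (coefficients₂ 1 (suc (double α)) (double (suc α))) (A 1 (suc (double α))) (B 1 (suc (double α)))
  (f 2 ^ (+ (8 ℕ.* 1))) (f 1 ^ (+ 24)) (f 2 ^ (+ (8 ℕ.* 1) - + 24))
  (^≋↑ (f 2) (8 ℕ.* 1))
  (one⊛⊛ (f 1 ^ (+ 24)) (f 2 ^ (+ (8 ℕ.* 1) - + 24)) (^≋↑ (f 1) 24) (^-negative≋↑ (f 2) (+ (8 ℕ.* 1) - + 24) 15 refl))
  refl (second₁ α) refl (λ n → p-second 1 0 1 α n refl)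

first-identity₂ : ∀ α → FirstIdentity 2 (double α)
first-identity₂ α = ∑≥-≈-⊞-1 (+ ⌊ 2 /2⌋) (coefficients₁ 2 (double α)) (A 2 (double α)) (B 2 (double α))
  (f 1 ^ (+ (8 ℕ.* 2))) (f 1 ^ (+ (8 ℕ.* 2) - + 24)) (f 2 ^ (+ 24))
  (^≋↑ (f 1) (8 ℕ.* 2))
  -- 16 - 24 = -8, which is `-[1+ 7 ]`.
  (one⊛⊛ (f 1 ^ (+ (8 ℕ.* 2) - + 24)) (f 2 ^ (+ 24)) (^-negative≋↑ (f 1) (+ (8 ℕ.* 2) - + 24) 7 refl) (^≋↑ (f 2) 24))
  refl (first₂ α) (p-first 2 α)

second-identity₂ : ∀ α → SecondIdentity 2 (suc (double α)) (double (suc α))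
second-identity₂ α =
  ∑≥-≈-⊞-−1 (- (+ ⌊ 2 /2⌋)) (coefficients₂ 2 (suc (double α)) (double (suc α))) (A 2 (suc (double α))) (B 2 (suc (double α)))
  (f 2 ^ (+ (8 ℕ.* 2))) (f 1 ^ (+ 24)) (f 2 ^ (+ (8 ℕ.* 2) - + 24))
  (^≋↑ (f 2) (8 ℕ.* 2))
  (one⊛⊛ (f 1 ^ (+ 24)) (f 2 ^ (+ (8 ℕ.* 2) - + 24)) (^≋↑ (f 1) 24) (^-negative≋↑ (f 2) (+ (8 ℕ.* 2) - + 24) 7 refl))
  refl (second₂ α) (λ n → p-second 2 1 0 α n refl)

first-identity₃ : ∀ α → FirstIdentity 3 (double α)
first-identity₃ α = ∑≥-≈-⊞-1 (+ ⌊ 3 /2⌋) (coefficients₁ 3 (double α)) (A 3 (double α)) (B 3 (double α))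
  (f 1 ^ (+ (8 ℕ.* 3))) (f 1 ^ (+ (8 ℕ.* 3) - + 24)) (f 2 ^ (+ 24))
  (^≋↑ (f 1) (8 ℕ.* 3))
  -- The exponent 24 - 24 vanishes, so the power of f₁ is `one` and disappears from the product.
  (≋-trans (one⊛⊛ (f 1 ^ (+ (8 ℕ.* 3) - + 24)) (f 2 ^ (+ 24)) (^-zero≋one (f 1) (+ (8 ℕ.* 3) - + 24) refl) (^≋↑ (f 2) 24)) (·-identityˡ (f 2 ↑ 24)))
  refl (first₃ α) (p-first 3 α)

second-identity₃ : ∀ α → SecondIdentity 3 (suc (double α)) (double (suc α))
second-identity₃ α =
  ∑≥-≈-⊞-−1 (- (+ ⌊ 3 /2⌋)) (coefficients₂ 3 (suc (double α)) (double (suc α))) (A 3 (suc (double α))) (B 3 (suc (double α)))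
  (f 2 ^ (+ (8 ℕ.* 3))) (f 1 ^ (+ 24)) (f 2 ^ (+ (8 ℕ.* 3) - + 24))
  (^≋↑ (f 2) (8 ℕ.* 3))
  (≋-trans (one⊛⊛ (f 1 ^ (+ 24)) (f 2 ^ (+ (8 ℕ.* 3) - + 24)) (^≋↑ (f 1) 24) (^-zero≋one (f 2) (+ (8 ℕ.* 3) - + 24) refl)) (·-identityʳ (f 1 ↑ 24)))
  refl (second₃ α) (λ n → p-second 3 1 1 α n refl)

2*≡double : ∀ α → 2 ℕ.* α ≡ double α
2*≡double α = trans (ℕₚ.*-comm 2 α) (double≡*2 α)

1≤k≤3-elim : (P : ℕ → Set) → P 1 → P 2 → P 3 → ∀ k → 1 ≤ k → k ≤ 3 → P k
1≤k≤3-elim P P1 P2 P3 1 _ _ = P1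
1≤k≤3-elim P P1 P2 P3 2 _ _ = P2
1≤k≤3-elim P P1 P2 P3 3 _ _ = P3
1≤k≤3-elim P P1 P2 P3 (suc (suc (suc (suc _)))) _ (s≤s (s≤s (s≤s ())))

first-identity : ∀ α k → 1 ≤ k → k ≤ 3 → FirstIdentity k (double α)
first-identity α = 1≤k≤3-elim (λ k → FirstIdentity k (double α))
  (first-identity₁ α) (first-identity₂ α) (first-identity₃ α)

second-identity : ∀ α k → 1 ≤ k → k ≤ 3 → SecondIdentity k (suc (double α)) (double (suc α))
second-identity α = 1≤k≤3-elim (λ k → SecondIdentity k (suc (double α)) (double (suc α)))
  (second-identity₁ α) (second-identity₂ α) (second-identity₃ α)

theorem1p1 :
  (k α : ℕ) → 1 ≤ k → k ≤ 3 →
    (∑≥ (+ 0) (λ n → p (+ (8 ℕ.* k)) (+ (2 ℕ.^ (2 ℕ.* α)) * n + + ((k ℕ.* (2 ℕ.^ (2 ℕ.* α) ∸ 1)) / 3)))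
      ≈ A k (2 ℕ.* α) • ⟦ f 1 ^ (+ (8 ℕ.* k)) ⟧
        ⊞ B k (2 ℕ.* α) • (q^ (+ ⌊ k /2⌋) ⊠ ⟦ f 1 ^ (+ (8 ℕ.* k) - + 24) ⟧ ⊠ ⟦ f 2 ^ (+ 24) ⟧))
    ×
    (∑≥ (- (+ ⌊ k /2⌋)) (λ n → p (+ (8 ℕ.* k)) (+ (2 ℕ.^ (2 ℕ.* α ℕ.+ 1)) * n + + ((k ℕ.* (2 ℕ.^ (2 ℕ.* α ℕ.+ 2) ∸ 1)) / 3)))
      ≈ A k (2 ℕ.* α ℕ.+ 1) • ⟦ f 2 ^ (+ (8 ℕ.* k)) ⟧
        ⊞ B k (2 ℕ.* α ℕ.+ 1) • (q^ (- (+ ⌊ k /2⌋)) ⊠ ⟦ f 1 ^ (+ 24) ⟧ ⊠ ⟦ f 2 ^ (+ (8 ℕ.* k) - + 24) ⟧))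
theorem1p1 k α 1≤k k≤3 =
    subst (FirstIdentity k) (sym (2*≡double α)) (first-identity α k 1≤k k≤3)
  , subst₂ (SecondIdentity k)
      (sym (trans (cong (ℕ._+ 1) (2*≡double α)) (ℕₚ.+-comm (double α) 1)))
      (sym (trans (cong (ℕ._+ 2) (2*≡double α)) (ℕₚ.+-comm (double α) 2)))
      (second-identity α k 1≤k k≤3)
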